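{- The characteristic polynomials of $BB^T$ for the L-shaped snake graphs are given by the expressions \begin{align*} \chi_{L_{2m,2n}}&=\left[Q_{m+n-1}-Q_{m-1}Q_{n-1}\right]\left[(x-1)Q_{m+n}+P_mP_n\right],\\ \chi_{L_{2m+1,2n+1}}&=\left[(x-1)Q_{m+n}-P_{m}P_{n}\right]\left[Q_{m+n+1}+Q_{m}Q_{n}\right],\\ \chi_{L_{2m,2n+1}}&=\left[P_{m+n}-Q_{m-1}P_{n}\right]\left[P_{m+n+1}+P_{m}Q_{n}\right]. \end{align*}
   Context: A snake graph is a plane graph consisting of a sequence of square tiles, each placed to the right of or on top of the previous one, adjacent tiles sharing exactly one edge. For natural numbers $r,s$, the (mirrored) L-shaped snake graph $L_{r,s}$ is created by placing first $r$ tiles to the right of each other and then $s-1$ tiles on top of each other (so it has one turning tile). The vertices are coloured black/white in the bipartition so that the two turns of the turning tile (its vertex with exactly 2 neighbours and its vertex with exactly 4 neighbours) are black. The graph is equipped with a Kasteleyn weighting $w\colon E\to\{\pm1\}$ (each face which is a $k$-gon, including the infinite face, has an odd number of edges of weight $-1$ if $k\equiv 0 \bmod 4$ and an even number if $k\equiv 2\bmod 4$), and $B$ is the weighted bipartite adjacency matrix (rows indexed by black vertices, columns by white vertices, entry $w(e)$ if joined by edge $e$, else $0$). $\chi_{L_{r,s}}=\chi_{L_{r,s}}(x)$ denotes the characteristic polynomial of $BB^T$ for $G=L_{r,s}$. The Fibonacci product polynomials are defined by $P_0=Q_0=1$ and, for $n\ge1$, $P_n(x)$ is the characteristic polynomial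 of the $n\times n$ tridiagonal matrix with diagonal $(2,3,3,\ldots,3)$ and all sub- and superdiagonal entries $1$, while $Q_n(x)$ is the characteristic polynomial of the $n\times n$ tridiagonal matrix with diagonal $(3,3,\ldots,3)$ and sub- and superdiagonal entries $1$; equivalently $P_{n+1}=(x-3)P_n-P_{n-1}$, $Q_{n+1}=(x-3)Q_n-Q_{n-1}$ with $P_1=x-2$, $Q_1=x-3$. Convention $Q_{ -1}=0$. -}

module Defs where

open import Data.Bool using (Bool; true; false; _∧_; _∨_; if_then_else_)
open import Data.Nat as ℕ using (ℕ; zero; suc; _∸_; _%_)
open import Data.Integer as ℤ using (ℤ; +_; -[1+_])
open import Data.List using (List; []; _∷_; _++_; map; concatMap; length; foldr; filterᵇ; deduplicateᵇ; applyUpTo)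
open import Data.Product using (_×_; _,_; proj₁; proj₂)
open import Relation.Nullary.Decidable using (⌊_⌋)
open import Relation.Binary.PropositionalEquality using (_≡_)

-- Polynomials over ℤ: coefficient lists, lowest degree first.

Poly : Set
Poly = List ℤ

infixl 6 _+P_ _-P_
infix 4 _≈P_
infixl 7 _*P_

_+P_ : Poly → Poly → Poly
[] +P q = q
(a ∷ p) +P [] = a ∷ p
(a ∷ p) +P (b ∷ q) = (a ℤ.+ b) ∷ (p +P q)

scaleP : ℤ → Poly → Poly
scaleP a = map (a ℤ.*_)

_*P_ : Poly → Poly → Poly
[] *P q = []
(a ∷ p) *P q = scaleP a q +P (+ 0 ∷ (p *P q))

negP : Poly → Poly
negP = map (λ a → ℤ.- a)

_-P_ : Poly → Poly → Poly
p -P q = p +P negP q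

constP : ℤ → Poly
constP c = c ∷ []

X : Poly
X = + 0 ∷ + 1 ∷ []

coeff : Poly → ℕ → ℤ
coeff [] _ = + 0
coeff (a ∷ p) zero = a
coeff (a ∷ p) (suc i) = coeff p i

_≈P_ : Poly → Poly → Set
p ≈P q = ∀ i → coeff p i ≡ coeff q i

-- Square matrices as lists of rows; determinant by Laplace expansion
-- along the first row.

Matrix : Set → Set
Matrix A = List (List A)

dropAt : {A : Set} → ℕ → List A → List A
dropAt _ [] = []
dropAt zero (x ∷ xs) = xs
dropAt (suc j) (x ∷ xs) = x ∷ dropAt j xs

signP : ℕ → Poly → Poly
signP j p = if ⌊ (j % 2) ℕ.≟ 0 ⌋ then p else negP p

detFuel : ℕ → Matrix Poly → Poly
detFuel zero _ = constP (+ 1)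
detFuel (suc n) [] = constP (+ 1)
detFuel (suc n) (r ∷ rs) = go 0 r
  where
  go : ℕ → List Poly → Poly
  go j [] = []
  go j (a ∷ as) = signP j (a *P detFuel n (map (dropAt j) rs)) +P go (suc j) as

det : Matrix Poly → Poly
det M = detFuel (length M) M

indexed : {A : Set} → List A → List (ℕ × A)
indexed xs = go 0 xs
  where
  go : {A : Set} → ℕ → List A → List (ℕ × A)
  go i [] = []
  go i (x ∷ xs) = (i , x) ∷ go (suc i) xs

charPoly : Matrix ℤ → Poly
charPoly M = det (map row (indexed M))
  where
  row : ℕ × List ℤ → List Poly
  row (i , r) = map (λ { (j , a) → (if ⌊ i ℕ.≟ j ⌋ then X else []) -P constP a }) (indexed r)

Pp : ℕ → Poly
Qp : ℕ → Poly
Pp zero = constP (+ 1)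
Pp (suc zero) = X -P constP (+ 2)
Pp (suc (suc n)) = (X -P constP (+ 3)) *P Pp (suc n) -P Pp n
Qp zero = constP (+ 1)
Qp (suc zero) = X -P constP (+ 3)
Qp (suc (suc n)) = (X -P constP (+ 3)) *P Qp (suc n) -P Qp n

-- Snake graphs on the integer grid.
-- A point (a , b) is the lattice point with coordinates (a,b).
-- Tile (a , b) is the unit square with corners (a,b),(a+1,b),(a,b+1),(a+1,b+1).

Pt : Set
Pt = ℕ × ℕ

data Dir : Set where
  H V : Dir   -- H: edge from p to p+(1,0);  V: edge from p to p+(0,1)

Edge : Set
Edge = Pt × Dir

_==ℕ_ : ℕ → ℕ → Bool
m ==ℕ n = ⌊ m ℕ.≟ n ⌋

_==Pt_ : Pt → Pt → Bool
(a , b) ==Pt (c , d) = (a ==ℕ c) ∧ (b ==ℕ d)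

_==Dir_ : Dir → Dir → Bool
H ==Dir H = true
V ==Dir V = true
_ ==Dir _ = false

_==E_ : Edge → Edge → Bool
(p , d) ==E (q , e) = (p ==Pt q) ∧ (d ==Dir e)

src : Edge → Pt
src = proj₁

tgt : Edge → Pt
tgt ((a , b) , H) = (suc a , b)
tgt ((a , b) , V) = (a , suc b)

-- tiles of the (mirrored) L-shaped snake graph L_{r,s}:
-- r tiles to the right, then s-1 tiles on top of the last one
tilesL : ℕ → ℕ → List Pt
tilesL r s = applyUpTo (λ i → (i , 0)) r ++ applyUpTo (λ j → (r ∸ 1 , suc j)) (s ∸ 1)

tileEdges : Pt → List Edge
tileEdges (a , b) = ((a , b) , H) ∷ ((a , suc b) , H) ∷ ((a , b) , V) ∷ ((suc a , b) , V) ∷ []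

tileCorners : Pt → List Pt
tileCorners (a , b) = (a , b) ∷ (suc a , b) ∷ (a , suc b) ∷ (suc a , suc b) ∷ []

verticesL : ℕ → ℕ → List Pt
verticesL r s = deduplicateᵇ _==Pt_ (concatMap tileCorners (tilesL r s))

edgesL : ℕ → ℕ → List Edge
edgesL r s = deduplicateᵇ _==E_ (concatMap tileEdges (tilesL r s))

-- edges lying on exactly one tile = the boundary of the infinite face
outerFaceL : ℕ → ℕ → List Edge
outerFaceL r s = filterᵇ (λ e → length (filterᵇ (e ==E_) (concatMap tileEdges (tilesL r s))) ==ℕ 1) (edgesL r s)

facesL : ℕ → ℕ → List (List Edge)
facesL r s = map tileEdges (tilesL r s) ++ (outerFaceL r s ∷ [])

Weighting : Set
Weighting = Edge → ℤ

minusOne : ℤ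
minusOne = -[1+ 0 ]

numNeg : Weighting → List Edge → ℕ
numNeg w f = length (filterᵇ (λ e → ⌊ w e ℤ.≟ minusOne ⌋) f)

KastFace : Weighting → List Edge → Set
KastFace w f = (length f % 4 ≡ 0 → numNeg w f % 2 ≡ 1)
             × (length f % 4 ≡ 2 → numNeg w f % 2 ≡ 0)

data AllL {A : Set} (P : A → Set) : List A → Set where
  []  : AllL P []
  _∷_ : ∀ {x xs} → P x → AllL P xs → AllL P (x ∷ xs)

data Sign : ℤ → Set where
  plus  : Sign (+ 1)
  minus : Sign minusOne

IsKasteleyn : ℕ → ℕ → Weighting → Set
IsKasteleyn r s w = AllL (λ e → Sign (w e)) (edgesL r s) × AllL (KastFace w) (facesL r s)

-- black vertices: same parity of a+b as the corner (r,0) of the turning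
-- tile (the turning tile's vertex with 2 neighbours); this class also
-- contains its vertex (r-1,1) with 4 neighbours.
isBlack : ℕ → Pt → Bool
isBlack r (a , b) = ((a ℕ.+ b) % 2) ==ℕ (r % 2)

notB : Bool → Bool
notB true = false
notB false = true

blackL : ℕ → ℕ → List Pt
blackL r s = filterᵇ (isBlack r) (verticesL r s)

whiteL : ℕ → ℕ → List Pt
whiteL r s = filterᵇ (λ p → notB (isBlack r p)) (verticesL r s)

sumℤ : List ℤ → ℤ
sumℤ = foldr ℤ._+_ (+ 0)

joins : Pt → Pt → Edge → Bool
joins p q e = ((src e ==Pt p) ∧ (tgt e ==Pt q)) ∨ ((src e ==Pt q) ∧ (tgt e ==Pt p))

entryB : ℕ → ℕ → Weighting → Pt → Pt → ℤ
entryB r s w p q = sumℤ (map w (filterᵇ (joins p q) (edgesL r s)))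

matB : ℕ → ℕ → Weighting → Matrix ℤ
matB r s w = map (λ p → map (entryB r s w p) (whiteL r s)) (blackL r s)

dot : List ℤ → List ℤ → ℤ
dot [] _ = + 0
dot (_ ∷ _) [] = + 0
dot (a ∷ as) (b ∷ bs) = a ℤ.* b ℤ.+ dot as bs

matBBt : ℕ → ℕ → Weighting → Matrix ℤ
matBBt r s w = map (λ u → map (dot u) (matB r s w)) (matB r s w)

chiL : ℕ → ℕ → Weighting → Poly
chiL r s w = charPoly (matBBt r s w)

{-# OPTIONS --safe #-}
module Submission where

-- Counting signed paths of length two between black vertices shows that B Bᵀ has degrees on
-- the diagonal, ±1 between black vertices two steps apart in a row or column, and 0 elsewhere: at
-- opposite corners of a tile the two paths cancel because the tile has an odd number of negative
-- edges. As the colour of a vertex (a , b) fixes a + b mod 2, the parity of b splits the black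
-- vertices into an outer and an inner path, so the determinant is a product of two tridiagonal
-- ones, which depend only on the degrees along the path. The degrees are 3 except at the ends and
-- at the corner (2 outside, 4 inside), and the resulting continuants are expressed through Q.

open import Defs
open import Level using (0ℓ)
open import Algebra using (CommutativeRing)
open import Data.Bool using (Bool; true; false; not; T; if_then_else_; _∧_; _∨_)
import Data.Bool.Properties as Boolₚ
open import Data.Nat as ℕ using (ℕ; zero; suc; _+_; _*_; _∸_; _≤_; _<_; z≤n; s≤s; _%_; ⌊_/2⌋; ⌈_/2⌉)
import Data.Nat.Properties as ℕₚ
open import Data.Integer as ℤ using (ℤ; +_)
import Data.Integer.Properties as ℤₚ
open import Data.List using (List; []; _∷_; _++_; _∷ʳ_; map; length; replicate; filter; filterᵇ; deduplicate; deduplicateᵇ; concatMap; applyUpTo)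
import Data.List.Properties as Lₚ
open import Data.List.Membership.Propositional using (_∈_; find; lose)
open import Data.List.Membership.Propositional.Properties
open import Data.List.Relation.Binary.Pointwise as Pointwise using (Pointwise; []; _∷_)
open import Data.List.Relation.Unary.All as All using (All; []; _∷_)
import Data.List.Relation.Unary.All.Properties as Allₚ
open import Data.List.Relation.Unary.AllPairs as AllPairs using ([]; _∷_)
open import Data.List.Relation.Unary.Any using (here; there)
open import Data.List.Relation.Unary.Linked using (Linked; []; [-]; _∷_)
open import Data.List.Relation.Unary.Unique.Propositional using (Unique)
import Data.List.Relation.Unary.Unique.Propositional.Properties as Uniqueₚ
import Data.List.Relation.Unary.Unique.DecPropositional.Properties as UniqueDecₚ
open import Data.Maybe using (Maybe; just; nothing)
open import Data.Product using (_×_; _,_; proj₁; proj₂; ∃-syntax; map₂)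
open import Data.Sum using (_⊎_; inj₁; inj₂; [_,_]′)
open import Data.Unit using (tt)
open import Function using (_∘_; id)
open import Function.Bundles using (Equivalence)
open import Relation.Binary using (IsEquivalence)
open import Relation.Binary.Definitions using (DecidableEquality)
open import Relation.Binary.PropositionalEquality
import Relation.Binary.Reasoning.Setoid
open import Relation.Nullary using (¬_; contradiction; yes; no; does)
open import Relation.Nullary.Decidable using (⌊_⌋; T?; ¬?; toWitness; fromWitness; map′)
open import Relation.Unary using (Decidable)
open import Tactic.RingSolver.Core.AlmostCommutativeRing
  using (AlmostCommutativeRing; fromCommutativeRing)

-- The corner dictates the shape of the factors. If it had degree 3, the continuant of a path with
-- `N` vertices would be `Q_N`, `P_N` or `(x-1) Q_(N-1)`, according to whether none, one or both of
-- its ends have degree 2. Writing `x - 2 = (x - 3) + 1` and `x - 4 = (x - 3) - 1` at the corner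
-- adds or subtracts the product of the continuants of the two arms left when the corner is removed.
-- So the factors with a plus belong to the outer path and those with a minus to the inner one.
--
-- The formal obstacle is that `blackL` follows the order of the tiles, so that the two paths are
-- interleaved, while `det` deletes rows and columns by position. Rows and columns are therefore
-- labelled by vertices, and the splitting is proved for arbitrary interleavings, with the sign of
-- the shuffle as correction. Filtering by class then yields each path already in its natural order.
--
-- The cancellation at tiles depends on the colouring: the one right-angled path of two edges that
-- bounds no tile has its middle at the vertex with four neighbours. That vertex is black, so the
-- ends of this path are white.

infix 4 _≋_

-- Unlike _≈P_, a record type lets Agda infer both sides from a proof.
record _≋_ (p q : Poly) : Set where
  constructor coeffwise
  field coeff≡ : p ≈P q
open _≋_

-- Integer polynomials as a commutative ring up to equality of coefficients

≋-isEquivalence : IsEquivalence _≋_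
≋-isEquivalence = record
  { refl  = coeffwise λ i → refl
  ; sym   = λ p≋q → coeffwise λ i → sym (coeff≡ p≋q i)
  ; trans = λ p≋q q≋r → coeffwise λ i → trans (coeff≡ p≋q i) (coeff≡ q≋r i)
  }

coeff-+ : ∀ p q i → coeff (p +P q) i ≡ coeff p i ℤ.+ coeff q i
coeff-+ []      q       i       = sym (ℤₚ.+-identityˡ _)
coeff-+ (a ∷ p) []      i       = sym (ℤₚ.+-identityʳ _)
coeff-+ (a ∷ p) (b ∷ q) zero    = refl
coeff-+ (a ∷ p) (b ∷ q) (suc i) = coeff-+ p q i

coeff-scale : ∀ a p i → coeff (scaleP a p) i ≡ a ℤ.* coeff p i
coeff-scale a []      i       = sym (ℤₚ.*-zeroʳ a)
coeff-scale a (b ∷ p) zero    = refl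
coeff-scale a (b ∷ p) (suc i) = coeff-scale a p i

coeff-neg : ∀ p i → coeff (negP p) i ≡ ℤ.- coeff p i
coeff-neg []      i       = refl
coeff-neg (b ∷ p) zero    = refl
coeff-neg (b ∷ p) (suc i) = coeff-neg p i

open IsEquivalence ≋-isEquivalence
  using () renaming (refl to ≋-refl; sym to ≋-sym; trans to ≋-trans)

∷-cong : ∀ {a b p q} → a ≡ b → p ≋ q → (a ∷ p) ≋ (b ∷ q)
∷-cong a≡b p≋q = coeffwise λ where
  zero    → a≡b
  (suc i) → coeff≡ p≋q i

shift-[] : (+ 0 ∷ []) ≋ []
shift-[] = coeffwise λ where
  zero    → refl
  (suc i) → refl

+P-cong : ∀ {p q r s} → p ≋ q → r ≋ s → (p +P r) ≋ (q +P s)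
+P-cong {p} {q} {r} {s} p≋q r≋s = coeffwise λ i →
  trans (coeff-+ p r i)
    (trans (cong₂ ℤ._+_ (coeff≡ p≋q i) (coeff≡ r≋s i)) (sym (coeff-+ q s i)))

+P-assoc : ∀ p q r → ((p +P q) +P r) ≋ (p +P (q +P r))
+P-assoc p q r = coeffwise λ i →
  trans (trans (coeff-+ (p +P q) r i) (cong (ℤ._+ coeff r i) (coeff-+ p q i)))
    (trans (ℤₚ.+-assoc (coeff p i) (coeff q i) (coeff r i))
      (sym (trans (coeff-+ p (q +P r) i) (cong (ℤ._+_ (coeff p i)) (coeff-+ q r i)))))

+P-comm : ∀ p q → (p +P q) ≋ (q +P p)
+P-comm p q = coeffwise λ i →
  trans (coeff-+ p q i)
    (trans (ℤₚ.+-comm (coeff p i) (coeff q i)) (sym (coeff-+ q p i)))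

+P-identityʳ : ∀ p → (p +P []) ≋ p
+P-identityʳ p = +P-comm p []

negP-cong : ∀ {p q} → p ≋ q → negP p ≋ negP q
negP-cong {p} {q} p≋q = coeffwise λ i →
  trans (coeff-neg p i) (trans (cong ℤ.-_ (coeff≡ p≋q i)) (sym (coeff-neg q i)))

negP-inverseʳ : ∀ p → (p +P negP p) ≋ []
negP-inverseʳ p = coeffwise λ i →
  trans (coeff-+ p (negP p) i)
    (trans (cong (ℤ._+_ (coeff p i)) (coeff-neg p i)) (ℤₚ.+-inverseʳ (coeff p i)))

scale-cong : ∀ a {p q} → p ≋ q → scaleP a p ≋ scaleP a q
scale-cong a {p} {q} p≋q = coeffwise λ i →
  trans (coeff-scale a p i) (trans (cong (a ℤ.*_) (coeff≡ p≋q i)) (sym (coeff-scale a q i)))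

scale-+ : ∀ a p q → scaleP a (p +P q) ≋ (scaleP a p +P scaleP a q)
scale-+ a p q = coeffwise λ i →
  trans (trans (coeff-scale a (p +P q) i) (cong (a ℤ.*_) (coeff-+ p q i)))
    (trans (ℤₚ.*-distribˡ-+ a (coeff p i) (coeff q i))
      (sym (trans (coeff-+ (scaleP a p) (scaleP a q) i)
        (cong₂ ℤ._+_ (coeff-scale a p i) (coeff-scale a q i)))))

scale-distrib : ∀ a b p → scaleP (a ℤ.+ b) p ≋ (scaleP a p +P scaleP b p)
scale-distrib a b p = coeffwise λ i →
  trans (coeff-scale (a ℤ.+ b) p i)
    (trans (ℤₚ.*-distribʳ-+ (coeff p i) a b)
      (sym (trans (coeff-+ (scaleP a p) (scaleP b p) i)
        (cong₂ ℤ._+_ (coeff-scale a p i) (coeff-scale b p i)))))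

scale-scale : ∀ a b p → scaleP a (scaleP b p) ≋ scaleP (a ℤ.* b) p
scale-scale a b p = coeffwise λ i →
  trans (trans (coeff-scale a (scaleP b p) i) (cong (a ℤ.*_) (coeff-scale b p i)))
    (trans (sym (ℤₚ.*-assoc a b (coeff p i))) (sym (coeff-scale (a ℤ.* b) p i)))

scale-zero : ∀ p → scaleP (+ 0) p ≋ []
scale-zero p = coeffwise λ i → coeff-scale (+ 0) p i

scale-one : ∀ p → scaleP (+ 1) p ≋ p
scale-one p = coeffwise λ i → trans (coeff-scale (+ 1) p i) (ℤₚ.*-identityˡ _)

+P-interchange : ∀ p q r s → ((p +P q) +P (r +P s)) ≋ ((p +P r) +P (q +P s))
+P-interchange p q r s =
  ≋-trans (+P-assoc p q (r +P s))
    (≋-trans (+P-cong (≋-refl {p})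
      (≋-trans (≋-sym (+P-assoc q r s))
        (≋-trans (+P-cong (+P-comm q r) (≋-refl {s})) (+P-assoc r q s))))
      (≋-sym (+P-assoc p r (q +P s))))

*P-zeroʳ : ∀ p → (p *P []) ≋ []
*P-zeroʳ []      = ≋-refl
*P-zeroʳ (a ∷ p) = ≋-trans (∷-cong refl (*P-zeroʳ p)) shift-[]

*P-congˡ : ∀ p {q r} → q ≋ r → (p *P q) ≋ (p *P r)
*P-congˡ []      q≋r = ≋-refl
*P-congˡ (a ∷ p) q≋r = +P-cong (scale-cong a q≋r) (∷-cong refl (*P-congˡ p q≋r))

*P-distribʳ-+P : ∀ r p q → ((p +P q) *P r) ≋ ((p *P r) +P (q *P r))
*P-distribʳ-+P r []      q       = ≋-refl
*P-distribʳ-+P r (a ∷ p) []      = ≋-sym (+P-identityʳ _)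
*P-distribʳ-+P r (a ∷ p) (b ∷ q) =
  ≋-trans (+P-cong (scale-distrib a b r) (∷-cong refl (*P-distribʳ-+P r p q)))
    (+P-interchange (scaleP a r) (scaleP b r) (+ 0 ∷ (p *P r)) (+ 0 ∷ (q *P r)))

-- `_*P_` recurses on its left factor; this supplies the recursion on the right factor, from which
-- commutativity follows.
*P-∷ : ∀ p b q → (p *P (b ∷ q)) ≋ (scaleP b p +P (+ 0 ∷ (p *P q)))
*P-∷ []      b q = ≋-sym shift-[]
*P-∷ (a ∷ p) b q = ∷-cong
  (trans (ℤₚ.+-identityʳ _) (trans (ℤₚ.*-comm a b) (sym (ℤₚ.+-identityʳ _))))
  (≋-trans (+P-cong (≋-refl {scaleP a q}) (*P-∷ p b q))
    (≋-trans (≋-sym (+P-assoc (scaleP a q) (scaleP b p) _))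
      (≋-trans (+P-cong (+P-comm (scaleP a q) (scaleP b p)) ≋-refl)
        (+P-assoc (scaleP b p) (scaleP a q) _))))

*P-comm : ∀ p q → (p *P q) ≋ (q *P p)
*P-comm []      q = ≋-sym (*P-zeroʳ q)
*P-comm (a ∷ p) q =
  ≋-trans (+P-cong (≋-refl {scaleP a q}) (∷-cong refl (*P-comm p q))) (≋-sym (*P-∷ q a p))

*P-cong : ∀ {p q r s} → p ≋ q → r ≋ s → (p *P r) ≋ (q *P s)
*P-cong {p} {q} {r} {s} p≋q r≋s =
  ≋-trans (*P-congˡ p r≋s)
    (≋-trans (*P-comm p s) (≋-trans (*P-congˡ s p≋q) (*P-comm s q)))

scale-*P : ∀ a p q → (scaleP a p *P q) ≋ scaleP a (p *P q)
scale-*P a []      q = ≋-refl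
scale-*P a (b ∷ p) q =
  ≋-trans (+P-cong (≋-sym (scale-scale a b q))
    (∷-cong (sym (ℤₚ.*-zeroʳ a)) (scale-*P a p q)))
    (≋-sym (scale-+ a (scaleP b q) (+ 0 ∷ (p *P q))))

shift-*P : ∀ p q → ((+ 0 ∷ p) *P q) ≋ (+ 0 ∷ (p *P q))
shift-*P p q = +P-cong (scale-zero q) ≋-refl

*P-assoc : ∀ p q r → ((p *P q) *P r) ≋ (p *P (q *P r))
*P-assoc []      q r = ≋-refl
*P-assoc (a ∷ p) q r =
  ≋-trans (*P-distribʳ-+P r (scaleP a q) (+ 0 ∷ (p *P q)))
    (+P-cong (scale-*P a q r)
      (≋-trans (shift-*P (p *P q) r) (∷-cong refl (*P-assoc p q r))))

*P-identityˡ : ∀ p → (constP (+ 1) *P p) ≋ p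
*P-identityˡ p =
  ≋-trans (+P-cong (scale-one p) shift-[]) (+P-identityʳ p)

polyRing : CommutativeRing 0ℓ 0ℓ
polyRing = record
  { Carrier = Poly ; _≈_ = _≋_ ; _+_ = _+P_ ; _*_ = _*P_ ; -_ = negP
  ; 0# = [] ; 1# = constP (+ 1)
  ; isCommutativeRing = record
    { isRing = record
      { +-isAbelianGroup = record
        { isGroup = record
          { isMonoid = record
            { isSemigroup = record
              { isMagma = record { isEquivalence = ≋-isEquivalence ; ∙-cong = +P-cong }
              ; assoc = +P-assoc }
            ; identity = (λ p → ≋-refl) , +P-identityʳ }
          ; inverse = (λ p → ≋-trans (+P-comm (negP p) p) (negP-inverseʳ p)) , negP-inverseʳ
          ; ⁻¹-cong = negP-cong }
        ; comm = +P-comm }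
      ; *-cong = *P-cong
      ; *-assoc = *P-assoc
      ; *-identity = *P-identityˡ
          , λ p → ≋-trans (*P-comm p (constP (+ 1))) (*P-identityˡ p)
      ; distrib =
          (λ p q r → ≋-trans (*P-comm p (q +P r))
            (≋-trans (*P-distribʳ-+P p q r) (+P-cong (*P-comm q p) (*P-comm r p))))
          , *P-distribʳ-+P }
    ; *-comm = *P-comm } }

-- The ring solver has to recognise constants that vanish, and lists of zeros of any length
-- represent the zero polynomial.
zero? : ∀ p → Maybe ([] ≋ p)
zero? [] = just ≋-refl
zero? (a ∷ p) with a ℤ.≟ + 0 | zero? p
... | yes refl | just []≋p = just (≋-trans (≋-sym shift-[]) (∷-cong refl []≋p))
... | _        | _         = nothing

polyACR : AlmostCommutativeRing 0ℓ 0ℓ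
polyACR = fromCommutativeRing polyRing zero?

open import Tactic.RingSolver.NonReflective polyACR
  using (solve; _⊕_; _⊗_; ⊝_; Κ) renaming (_⊜_ to infix 4 _⊜_)

open CommutativeRing polyRing using () renaming (setoid to polySetoid)
module ≋-Reasoning = Relation.Binary.Reasoning.Setoid polySetoid

-- Determinants as minors labelled by lists of rows and columns

cofactors : ℕ → Matrix Poly → ℕ → List Poly → Poly
cofactors n rs j [] = []
cofactors n rs j (a ∷ as) =
  signP j (a *P detFuel n (map (dropAt j) rs)) +P cofactors n rs (suc j) as

-- The recursion equations determine the function, so the unnamed local one can be exchanged for
-- `cofactors`. The extra argument `r` is there because the local function is also abstracted over
-- the whole first row.
cofactors-unique : ∀ n rs (g : List Poly → ℕ → List Poly → Poly) →
  (∀ r j → g r j [] ≡ []) →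
  (∀ r j a as → g r j (a ∷ as) ≡
    signP j (a *P detFuel n (map (dropAt j) rs)) +P g r (suc j) as) →
  ∀ r j as → g r j as ≡ cofactors n rs j as
cofactors-unique n rs g g[] g∷ r j []       = g[] r j
cofactors-unique n rs g g[] g∷ r j (a ∷ as) =
  trans (g∷ r j a as) (cong (_ +P_) (cofactors-unique n rs g g[] g∷ r (suc j) as))

-- The local function of detFuel has no name outside Defs: unification against a call
-- with all arguments generalised to variables recovers it.
mutual
  detFuel-go : ℕ → Matrix Poly → List Poly → ℕ → List Poly → Poly
  detFuel-go = _

  detFuel≡cofactors : ∀ n r rs → detFuel (suc n) (r ∷ rs) ≡ cofactors n rs 0 r
  detFuel≡cofactors n []       rs = refl
  detFuel≡cofactors n (a ∷ as) rs with a ∷ as | suc zero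
  ... | r | j = cong (_ +P_)
    (cofactors-unique n rs (detFuel-go n rs) (λ _ _ → refl) (λ _ _ _ _ → refl) r j as)

enumerate : {A : Set} → ℕ → List A → List (ℕ × A)
enumerate i []       = []
enumerate i (x ∷ xs) = (i , x) ∷ enumerate (suc i) xs

enumerate-unique : ∀ {A : Set} (g : List A → ℕ → List A → List (ℕ × A)) →
  (∀ r i → g r i [] ≡ []) →
  (∀ r i x xs → g r i (x ∷ xs) ≡ (i , x) ∷ g r (suc i) xs) →
  ∀ r i xs → g r i xs ≡ enumerate i xs
enumerate-unique g g[] g∷ r i []       = g[] r i
enumerate-unique g g[] g∷ r i (x ∷ xs) =
  trans (g∷ r i x xs) (cong (_ ∷_) (enumerate-unique g g[] g∷ r (suc i) xs))

mutual
  indexed-go : {A : Set} → List A → ℕ → List A → List (ℕ × A)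
  indexed-go = _

  indexed≡enumerate : {A : Set} (xs : List A) → indexed xs ≡ enumerate 0 xs
  indexed≡enumerate []       = refl
  indexed≡enumerate (x ∷ xs) with x ∷ xs | suc zero
  ... | r | i = cong (_ ∷_)
    (enumerate-unique indexed-go (λ _ _ → refl) (λ _ _ _ _ → refl) r i xs)

1P : Poly
1P = constP (+ 1)

≡⇒≋ : ∀ {p q} → p ≡ q → p ≋ q
≡⇒≋ refl = ≋-refl

*P-congʳ : ∀ r {p q} → p ≋ q → (p *P r) ≋ (q *P r)
*P-congʳ r p≋q = *P-cong p≋q (≋-refl {r})

neg1^_ : ℕ → Poly
neg1^ zero  = 1P
neg1^ suc n = negP (neg1^ n)

neg1^-square : ∀ n → (neg1^ n *P neg1^ n) ≋ 1P
neg1^-square zero    = *P-identityˡ 1P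
neg1^-square (suc n) =
  ≋-trans (solve 1 (λ s → (⊝ s) ⊗ (⊝ s) ⊜ s ⊗ s) ≋-refl (neg1^ n)) (neg1^-square n)

signP≋ : ∀ j p → signP j p ≋ (neg1^ j *P p)
signP≋ zero          p = ≋-sym (*P-identityˡ p)
signP≋ (suc zero)    p = solve 1 (λ p → ⊝ p ⊜ (⊝ Κ 1P) ⊗ p) ≋-refl p
signP≋ (suc (suc j)) p =
  ≋-trans (signP≋ j p)
    (solve 2 (λ s p → s ⊗ p ⊜ (⊝ (⊝ s)) ⊗ p) ≋-refl (neg1^ j) p)

dropAt-++ : ∀ {A : Set} (xs : List A) y ys → dropAt (length xs) (xs ++ y ∷ ys) ≡ xs ++ ys
dropAt-++ []       y ys = refl
dropAt-++ (x ∷ xs) y ys = cong (x ∷_) (dropAt-++ xs y ys)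

-- With labels, deleting a column by position becomes removing an element from a list, so that facts
-- about pairs of vertices apply inside every minor.
module Laplace {A : Set} (f : A → A → Poly) where

  submatrix : List A → List A → Matrix Poly
  submatrix rows cols = map (λ p → map (f p) cols) rows

  minor : List A → List A → Poly
  expandRow : A → List A → List A → List A → Poly

  minor []       cols = 1P
  minor (p ∷ ps) cols = expandRow p ps [] cols

  -- The part of the expansion along row p that comes from the columns in suf;
  -- the columns in pre stand to their left.
  expandRow p ps pre []        = []
  expandRow p ps pre (q ∷ suf) =
    (neg1^ length pre *P (f p q *P minor ps (pre ++ suf))) +P expandRow p ps (pre ∷ʳ q) suf

  dropAt-submatrix : ∀ rows pre q suf →
    map (dropAt (length pre)) (submatrix rows (pre ++ q ∷ suf)) ≡ submatrix rows (pre ++ suf)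
  dropAt-submatrix []       pre q suf = refl
  dropAt-submatrix (p ∷ ps) pre q suf = cong₂ _∷_ row (dropAt-submatrix ps pre q suf)
    where
    open ≡-Reasoning
    row : dropAt (length pre) (map (f p) (pre ++ q ∷ suf)) ≡ map (f p) (pre ++ suf)
    row = begin
      dropAt (length pre) (map (f p) (pre ++ q ∷ suf))
        ≡⟨ cong₂ dropAt (sym (Lₚ.length-map (f p) pre)) (Lₚ.map-++ (f p) pre (q ∷ suf)) ⟩
      dropAt (length (map (f p) pre)) (map (f p) pre ++ f p q ∷ map (f p) suf)
        ≡⟨ dropAt-++ (map (f p) pre) (f p q) (map (f p) suf) ⟩
      map (f p) pre ++ map (f p) suf
        ≡⟨ Lₚ.map-++ (f p) pre suf ⟨
      map (f p) (pre ++ suf) ∎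

  detFuel-minor : ∀ rows cols → detFuel (length rows) (submatrix rows cols) ≋ minor rows cols
  cofactors-expandRow : ∀ p ps pre suf cols → cols ≡ pre ++ suf →
    cofactors (length ps) (submatrix ps cols) (length pre) (map (f p) suf) ≋ expandRow p ps pre suf

  detFuel-minor []       cols = ≋-refl
  detFuel-minor (p ∷ ps) cols =
    ≋-trans (≡⇒≋ (detFuel≡cofactors (length ps) (map (f p) cols) (submatrix ps cols)))
      (cofactors-expandRow p ps [] cols cols refl)

  cofactors-expandRow p ps pre []        cols eq   = ≋-refl
  cofactors-expandRow p ps pre (q ∷ suf) cols refl = +P-cong
    (≋-trans (signP≋ (length pre) _)
      (*P-congˡ (neg1^ length pre) (*P-congˡ (f p q)
        (≋-trans (≡⇒≋ (cong (detFuel (length ps)) (dropAt-submatrix ps pre q suf)))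
          (detFuel-minor ps (pre ++ suf))))))
    (subst (λ j → cofactors (length ps) (submatrix ps cols) j (map (f p) suf)
        ≋ expandRow p ps (pre ∷ʳ q) suf)
      (trans (Lₚ.length-++ pre) (ℕₚ.+-comm (length pre) 1))
      (cofactors-expandRow p ps (pre ∷ʳ q) suf cols (sym (Lₚ.∷ʳ-++ pre q suf))))

  expandRow-zeroRow : ∀ p ps pre {suf} → All (λ q → f p q ≋ []) suf → expandRow p ps pre suf ≋ []
  expandRow-zeroRow p ps pre []                       = ≋-refl
  expandRow-zeroRow p ps pre (_∷_ {q} {suf} fpq≋0 f≋0) =
    ≋-trans (+P-cong (*P-congˡ (neg1^ length pre) (*P-congʳ (minor ps (pre ++ suf)) fpq≋0))
      (expandRow-zeroRow p ps (pre ∷ʳ q) f≋0))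
      (≋-trans (+P-identityʳ _) (*P-zeroʳ (neg1^ length pre)))

  -- Since `minor` expands along rows only, a zero column is followed through the whole expansion:
  -- every term either takes its entry from column `z` or keeps `z` in the smaller minor. The
  -- condition on lengths ensures that the rows do not run out first, as a minor without rows is 1.
  minor-zeroColumn : ∀ rows z cols → All (λ p → f p z ≋ []) rows →
    length rows ≡ suc (length cols) → minor rows (z ∷ cols) ≋ []
  expandRow-zeroColumn : ∀ p ps z pre suf → All (λ p → f p z ≋ []) ps →
    length ps ≡ length (pre ++ suf) → expandRow p ps (z ∷ pre) suf ≋ []

  minor-zeroColumn (p ∷ ps) z cols (fpz≋0 ∷ f≋0) eq =
    ≋-trans (+P-cong
        (*P-congˡ 1P (*P-congʳ (minor ps cols) fpz≋0))
        (expandRow-zeroColumn p ps z [] cols f≋0 (ℕₚ.suc-injective eq)))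
      (≋-trans (+P-identityʳ _) (*P-zeroʳ 1P))

  expandRow-zeroColumn p ps z pre []        f≋0 eq = ≋-refl
  expandRow-zeroColumn p ps z pre (q ∷ suf) f≋0 eq =
    ≋-trans (+P-cong
        (*P-congˡ (neg1^ suc (length pre)) (*P-congˡ (f p q)
          (minor-zeroColumn ps z (pre ++ suf) f≋0 (trans eq (Lₚ.length-++-sucʳ pre q suf)))))
        (expandRow-zeroColumn p ps z (pre ∷ʳ q) suf f≋0
          (trans eq (cong length (sym (Lₚ.∷ʳ-++ pre q suf))))))
      (≋-trans (+P-identityʳ _)
        (≋-trans (*P-congˡ (neg1^ suc (length pre)) (*P-zeroʳ (f p q)))
          (*P-zeroʳ (neg1^ suc (length pre)))))

-- Determinants of matrices whose entries vanish between two classes of labels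

module BlockSplitting {A : Set} (f : A → A → Poly) (c : A → Bool) where

  open Laplace f

  red blue : List A → List A
  red  = filterᵇ c
  blue = filterᵇ (not ∘ c)

  #red #blue : List A → ℕ
  #red  xs = length (red xs)
  #blue xs = length (blue xs)

  -- Sign of the shuffle that moves the red elements to the front.
  shuffleSign : List A → Poly
  shuffleSign []       = 1P
  shuffleSign (x ∷ xs) =
    if c x then shuffleSign xs else ((neg1^ #red xs) *P shuffleSign xs)

  #red-red : ∀ xs {y} ys → c y ≡ true → #red (xs ++ y ∷ ys) ≡ suc (#red (xs ++ ys))
  #red-red []       ys cy rewrite cy = refl
  #red-red (x ∷ xs) ys cy with c x
  ... | true  = cong suc (#red-red xs ys cy)
  ... | false = #red-red xs ys cy

  red-blue : ∀ xs {y} ys → c y ≡ false → red (xs ++ y ∷ ys) ≡ red (xs ++ ys)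
  red-blue []       ys cy rewrite cy = refl
  red-blue (x ∷ xs) ys cy with c x
  ... | true  = cong (x ∷_) (red-blue xs ys cy)
  ... | false = red-blue xs ys cy

  blue-red : ∀ xs {y} ys → c y ≡ true → blue (xs ++ y ∷ ys) ≡ blue (xs ++ ys)
  blue-red []       ys cy rewrite cy = refl
  blue-red (x ∷ xs) ys cy with c x
  ... | true  = blue-red xs ys cy
  ... | false = cong (x ∷_) (blue-red xs ys cy)

  -- Deleting a red element removes one inversion for each blue element of `pre`. Their number is
  -- `length pre` minus `#red pre`; the two signs stand on opposite sides to avoid the subtraction.
  shuffleSign-red : ∀ pre {q} suf → c q ≡ true →
    (shuffleSign (pre ++ q ∷ suf) *P neg1^ #red pre)
      ≋ (neg1^ length pre *P shuffleSign (pre ++ suf))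
  shuffleSign-red []        suf cq rewrite cq = *P-comm (shuffleSign suf) 1P
  shuffleSign-red (x ∷ pre) {q} suf cq with c x
  ... | true  =
    ≋-trans (solve 2 (λ s e → s ⊗ (⊝ e) ⊜ ⊝ (s ⊗ e)) ≋-refl
              (shuffleSign (pre ++ q ∷ suf)) (neg1^ #red pre))
      (≋-trans (negP-cong (shuffleSign-red pre suf cq))
        (solve 2 (λ s e → ⊝ (e ⊗ s) ⊜ (⊝ e) ⊗ s) ≋-refl
          (shuffleSign (pre ++ suf)) (neg1^ length pre)))
  ... | false rewrite #red-red pre suf cq =
    ≋-trans (solve 3 (λ s e k → ((⊝ k) ⊗ s) ⊗ e ⊜ ⊝ (k ⊗ (s ⊗ e))) ≋-refl
              (shuffleSign (pre ++ q ∷ suf)) (neg1^ #red pre) (neg1^ #red (pre ++ suf)))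
      (≋-trans (negP-cong (*P-congˡ (neg1^ #red (pre ++ suf)) (shuffleSign-red pre suf cq)))
        (solve 3 (λ s e k → ⊝ (k ⊗ (e ⊗ s)) ⊜ (⊝ e) ⊗ (k ⊗ s)) ≋-refl
          (shuffleSign (pre ++ suf)) (neg1^ length pre) (neg1^ #red (pre ++ suf))))

  -- Deleting a blue element removes one inversion for each red element of `suf`. Their number has
  -- the parity of `#red pre + #red (pre ++ suf)`, where `#red pre` is `length pre` minus
  -- `#blue pre`.
  shuffleSign-blue : ∀ pre {q} suf → c q ≡ false →
    (shuffleSign (pre ++ q ∷ suf) *P neg1^ #blue pre)
      ≋ (neg1^ length pre *P (neg1^ #red (pre ++ suf) *P shuffleSign (pre ++ suf)))
  shuffleSign-blue []        suf cq rewrite cq =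
    *P-comm (neg1^ #red suf *P shuffleSign suf) 1P
  shuffleSign-blue (x ∷ pre) {q} suf cq with c x
  ... | true  =
    ≋-trans (shuffleSign-blue pre suf cq)
      (solve 3 (λ s e k → e ⊗ (k ⊗ s) ⊜ (⊝ e) ⊗ ((⊝ k) ⊗ s)) ≋-refl
        (shuffleSign (pre ++ suf)) (neg1^ length pre) (neg1^ #red (pre ++ suf)))
  ... | false rewrite red-blue pre suf cq =
    ≋-trans (solve 3 (λ s e k → (k ⊗ s) ⊗ (⊝ e) ⊜ ⊝ (k ⊗ (s ⊗ e))) ≋-refl
              (shuffleSign (pre ++ q ∷ suf)) (neg1^ #blue pre) (neg1^ #red (pre ++ suf)))
      (≋-trans (negP-cong (*P-congˡ (neg1^ #red (pre ++ suf)) (shuffleSign-blue pre suf cq)))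
        (solve 3 (λ s e k → ⊝ (k ⊗ (e ⊗ (k ⊗ s))) ⊜ (⊝ e) ⊗ (k ⊗ (k ⊗ s))) ≋-refl
          (shuffleSign (pre ++ suf)) (neg1^ length pre) (neg1^ #red (pre ++ suf))))

  shuffleSign-square : ∀ xs → (shuffleSign xs *P shuffleSign xs) ≋ 1P
  shuffleSign-square []       = *P-identityˡ 1P
  shuffleSign-square (x ∷ xs) with c x
  ... | true  = shuffleSign-square xs
  ... | false =
    ≋-trans (solve 2 (λ k s → (k ⊗ s) ⊗ (k ⊗ s) ⊜ (k ⊗ k) ⊗ (s ⊗ s)) ≋-refl
              (neg1^ #red xs) (shuffleSign xs))
      (≋-trans (*P-cong (neg1^-square (#red xs)) (shuffleSign-square xs)) (*P-identityˡ 1P))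

  shuffleSign-allBlue : ∀ xs → #red xs ≡ 0 → shuffleSign xs ≋ 1P
  shuffleSign-allBlue []       _ = ≋-refl
  shuffleSign-allBlue (x ∷ xs) eq with c x
  ... | false rewrite eq = ≋-trans (*P-identityˡ _) (shuffleSign-allBlue xs eq)

  module _ (Good : A → Set)
           (f-mixed : ∀ {p q} → Good p → Good q → c p ≢ c q → f p q ≋ []) where

    private
      -- Rows and columns are separate lists because a cofactor deletes different elements from
      -- them. The equality of the red counts persists in every term that does not vanish, since
      -- there both deleted elements have the same colour.
      Splits : List A → Set
      Splits rows = ∀ cols → All Good rows → All Good cols → #red rows ≡ #red cols →
        minor rows cols ≋ ((shuffleSign rows *P shuffleSign cols)
          *P (minor (red rows) (red cols) *P minor (blue rows) (blue cols)))

      goodSuffix : ∀ pre {q suf} → All Good (pre ++ q ∷ suf) → Good q × All Good (pre ++ suf)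
      goodSuffix []        (g ∷ gs) = g , gs
      goodSuffix (x ∷ pre) (g ∷ gs) with goodSuffix pre gs
      ... | gq , gs′ = gq , g ∷ gs′

      dropTerm : ∀ {d x y} s e → x ≋ [] → y ≋ d → (s *P (x *P e) +P y) ≋ d
      dropTerm s e x≋0 y≋d =
        ≋-trans (+P-cong (*P-congˡ s (*P-congʳ e x≋0)) y≋d)
          (+P-cong (*P-zeroʳ s) ≋-refl)

      -- In a red row the blue columns contribute nothing. A red column carries the sign of its
      -- position among all columns, which `shuffleSign-red` trades for the sign of its position
      -- among the red ones.
      expandRed : ∀ {p} ps → c p ≡ true → Good p → Splits ps → All Good ps →
        ∀ pre suf cols redPre → cols ≡ pre ++ suf → redPre ≡ red pre →
        All Good cols → suc (#red ps) ≡ #red cols →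
        expandRow p ps pre suf ≋ ((shuffleSign ps *P shuffleSign cols)
          *P (expandRow p (red ps) redPre (red suf) *P minor (blue ps) (blue cols)))
      expandRed ps cp gp IH gps pre [] cols redPre eq₁ eq₂ gcols eq₃ =
        ≋-sym (*P-zeroʳ (shuffleSign ps *P shuffleSign cols))
      expandRed {p} ps cp gp IH gps pre (q ∷ suf) cols redPre refl refl gcols eq₃
        with c q in cq
      ... | false = dropTerm (neg1^ length pre) (minor ps (pre ++ suf))
        (f-mixed gp (proj₁ (goodSuffix pre gcols)) λ eq → case-⊥ (trans (sym cp) (trans eq cq)))
        (expandRed ps cp gp IH gps (pre ∷ʳ q) suf cols redPre
          (sym (Lₚ.∷ʳ-++ pre q suf))
          (sym (trans (red-blue pre [] cq) (cong red (Lₚ.++-identityʳ pre))))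
          gcols eq₃)
        where
        case-⊥ : true ≢ false
        case-⊥ ()
      ... | true = begin
        neg1^ length pre *P (f p q *P minor ps (pre ++ suf)) +P expandRow p ps (pre ∷ʳ q) suf
          ≈⟨ +P-cong (*P-congˡ (neg1^ length pre) (*P-congˡ (f p q)
               (IH (pre ++ suf) gps (proj₂ (goodSuffix pre gcols))
                 (ℕₚ.suc-injective (trans eq₃ (#red-red pre suf cq))))))
             (expandRed ps cp gp IH gps (pre ∷ʳ q) suf cols (red pre ∷ʳ q)
               (sym (Lₚ.∷ʳ-++ pre q suf)) red-∷ʳ gcols eq₃) ⟩
        neg1^ length pre *P (f p q *P ((shuffleSign ps *P shuffleSign (pre ++ suf))
            *P (minor (red ps) (red (pre ++ suf)) *P minor (blue ps) (blue (pre ++ suf)))))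
          +P (shuffleSign ps *P shuffleSign cols) *P (rest *P minor (blue ps) (blue cols))
          ≈⟨ +P-cong (≋-trans
               (solve 6 (λ e φ s t u v →
                   e ⊗ (φ ⊗ ((s ⊗ t) ⊗ (u ⊗ v))) ⊜ (e ⊗ t) ⊗ (φ ⊗ (s ⊗ (u ⊗ v)))) ≋-refl
                 (neg1^ length pre) (f p q) (shuffleSign ps) (shuffleSign (pre ++ suf))
                 (minor (red ps) (red (pre ++ suf))) (minor (blue ps) (blue (pre ++ suf))))
               (*P-cong (≋-sym (shuffleSign-red pre suf cq))
                 (*P-congˡ (f p q) (*P-congˡ (shuffleSign ps) (*P-cong
                   (≡⇒≋ (cong (minor (red ps)) (Lₚ.filter-++ (T? ∘ c) pre suf)))
                   (≡⇒≋ (cong (minor (blue ps)) (sym (blue-red pre suf cq)))))))))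
             ≋-refl ⟩
        (shuffleSign cols *P neg1^ #red pre)
            *P (f p q *P (shuffleSign ps
              *P (minor (red ps) (red pre ++ red suf) *P minor (blue ps) (blue cols))))
          +P (shuffleSign ps *P shuffleSign cols) *P (rest *P minor (blue ps) (blue cols))
          ≈⟨ solve 7 (λ s e φ t u v r →
                 (s ⊗ e) ⊗ (φ ⊗ (t ⊗ (u ⊗ v))) ⊕ (t ⊗ s) ⊗ (r ⊗ v)
                   ⊜ (t ⊗ s) ⊗ ((e ⊗ (φ ⊗ u) ⊕ r) ⊗ v)) ≋-refl
               (shuffleSign cols) (neg1^ #red pre) (f p q) (shuffleSign ps)
               (minor (red ps) (red pre ++ red suf)) (minor (blue ps) (blue cols)) rest ⟩
        (shuffleSign ps *P shuffleSign cols)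
          *P ((neg1^ #red pre *P (f p q *P minor (red ps) (red pre ++ red suf)) +P rest)
            *P minor (blue ps) (blue cols)) ∎
        where
        open ≋-Reasoning
        rest : Poly
        rest = expandRow p (red ps) (red pre ∷ʳ q) (red suf)
        red-∷ʳ : red pre ∷ʳ q ≡ red (pre ∷ʳ q)
        red-∷ʳ = trans (cong (red pre ++_) (sym red-q)) (sym (Lₚ.filter-++ (T? ∘ c) pre (q ∷ [])))
          where
          red-q : red (q ∷ []) ≡ q ∷ []
          red-q rewrite cq = refl

      -- The additional `neg1^ #red ps` is the share of the row `p` itself in the shuffle sign of
      -- the rows: all red rows of `ps` have to pass it.
      expandBlue : ∀ {p} ps → c p ≡ false → Good p → Splits ps → All Good ps →
        ∀ pre suf cols bluePre → cols ≡ pre ++ suf → bluePre ≡ blue pre →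
        All Good cols → #red ps ≡ #red cols →
        expandRow p ps pre suf ≋ (((neg1^ #red ps *P shuffleSign ps) *P shuffleSign cols)
          *P (minor (red ps) (red cols) *P expandRow p (blue ps) bluePre (blue suf)))
      expandBlue ps cp gp IH gps pre [] cols bluePre eq₁ eq₂ gcols eq₃ = ≋-sym
        (≋-trans (*P-congˡ ((neg1^ #red ps *P shuffleSign ps) *P shuffleSign cols)
            (*P-zeroʳ (minor (red ps) (red cols))))
          (*P-zeroʳ ((neg1^ #red ps *P shuffleSign ps) *P shuffleSign cols)))
      expandBlue {p} ps cp gp IH gps pre (q ∷ suf) cols bluePre refl refl gcols eq₃
        with c q in cq
      ... | true = dropTerm (neg1^ length pre) (minor ps (pre ++ suf))
        (f-mixed gp (proj₁ (goodSuffix pre gcols)) λ eq → case-⊥ (trans (sym cp) (trans eq cq)))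
        (expandBlue ps cp gp IH gps (pre ∷ʳ q) suf cols bluePre
          (sym (Lₚ.∷ʳ-++ pre q suf))
          (sym (trans (blue-red pre [] cq) (cong blue (Lₚ.++-identityʳ pre))))
          gcols eq₃)
        where
        case-⊥ : false ≢ true
        case-⊥ ()
      ... | false = begin
        neg1^ length pre *P (f p q *P minor ps (pre ++ suf)) +P expandRow p ps (pre ∷ʳ q) suf
          ≈⟨ +P-cong (*P-congˡ (neg1^ length pre) (*P-congˡ (f p q)
               (IH (pre ++ suf) gps (proj₂ (goodSuffix pre gcols)) #red≡)))
             (expandBlue ps cp gp IH gps (pre ∷ʳ q) suf cols (blue pre ∷ʳ q)
               (sym (Lₚ.∷ʳ-++ pre q suf)) blue-∷ʳ gcols eq₃) ⟩
        neg1^ length pre *P (f p q *P ((shuffleSign ps *P shuffleSign (pre ++ suf))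
            *P (minor (red ps) (red (pre ++ suf)) *P minor (blue ps) (blue (pre ++ suf)))))
          +P (σₚ *P shuffleSign cols) *P (minor (red ps) (red cols) *P rest)
          ≈⟨ +P-cong (≋-trans
               -- A factor 1 is inserted as the square of `neg1^ #red ps`: one copy completes the
               -- sign of the rows, the other is the one that `shuffleSign-blue` needs for the
               -- columns.
               (≋-trans (≋-sym (*P-identityˡ _))
                 (*P-congʳ (neg1^ length pre *P (f p q *P ((shuffleSign ps *P shuffleSign (pre ++ suf))
                      *P (minor (red ps) (red (pre ++ suf)) *P minor (blue ps) (blue (pre ++ suf))))))
                   (≋-sym (neg1^-square (#red ps)))))
               (≋-trans
                 (solve 7 (λ k e φ s t u v →
                     (k ⊗ k) ⊗ (e ⊗ (φ ⊗ ((s ⊗ t) ⊗ (u ⊗ v))))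
                       ⊜ (e ⊗ (k ⊗ t)) ⊗ (φ ⊗ ((k ⊗ s) ⊗ (u ⊗ v)))) ≋-refl
                   (neg1^ #red ps) (neg1^ length pre) (f p q) (shuffleSign ps)
                   (shuffleSign (pre ++ suf))
                   (minor (red ps) (red (pre ++ suf))) (minor (blue ps) (blue (pre ++ suf))))
                 (*P-cong
                   (≋-trans (*P-congˡ (neg1^ length pre)
                       (*P-congʳ (shuffleSign (pre ++ suf)) (≡⇒≋ (cong neg1^_ #red≡))))
                     (≋-sym (shuffleSign-blue pre suf cq)))
                   (*P-congˡ (f p q) (*P-congˡ σₚ (*P-cong
                     (≡⇒≋ (cong (minor (red ps)) (sym (red-blue pre suf cq))))
                     (≡⇒≋ (cong (minor (blue ps)) (Lₚ.filter-++ (T? ∘ not ∘ c) pre suf)))))))))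
             ≋-refl ⟩
        (shuffleSign cols *P neg1^ #blue pre)
            *P (f p q *P (σₚ
              *P (minor (red ps) (red cols) *P minor (blue ps) (blue pre ++ blue suf))))
          +P (σₚ *P shuffleSign cols) *P (minor (red ps) (red cols) *P rest)
          ≈⟨ solve 7 (λ s e φ t u v r →
                 (s ⊗ e) ⊗ (φ ⊗ (t ⊗ (v ⊗ u))) ⊕ (t ⊗ s) ⊗ (v ⊗ r)
                   ⊜ (t ⊗ s) ⊗ (v ⊗ (e ⊗ (φ ⊗ u) ⊕ r))) ≋-refl
               (shuffleSign cols) (neg1^ #blue pre) (f p q) σₚ
               (minor (blue ps) (blue pre ++ blue suf)) (minor (red ps) (red cols)) rest ⟩
        (σₚ *P shuffleSign cols)
          *P (minor (red ps) (red cols)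
            *P (neg1^ #blue pre *P (f p q *P minor (blue ps) (blue pre ++ blue suf)) +P rest)) ∎
        where
        open ≋-Reasoning
        σₚ rest : Poly
        σₚ   = neg1^ #red ps *P shuffleSign ps
        rest = expandRow p (blue ps) (blue pre ∷ʳ q) (blue suf)
        #red≡ : #red ps ≡ #red (pre ++ suf)
        #red≡ = trans eq₃ (cong length (red-blue pre suf cq))
        blue-∷ʳ : blue pre ∷ʳ q ≡ blue (pre ∷ʳ q)
        blue-∷ʳ = trans (cong (blue pre ++_) (sym blue-q))
          (sym (Lₚ.filter-++ (T? ∘ not ∘ c) pre (q ∷ [])))
          where
          blue-q : blue (q ∷ []) ≡ q ∷ []
          blue-q rewrite cq = refl

      splits : ∀ rows → Splits rows
      splits [] cols _ _ eq = ≋-sym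
        (≋-trans (*P-congʳ (1P *P 1P)
            (≋-trans (*P-identityˡ _) (shuffleSign-allBlue cols (sym eq))))
          (≋-trans (*P-identityˡ _) (*P-identityˡ 1P)))
      splits (p ∷ ps) cols (gp ∷ gps) gcols eq with c p in cp
      ... | true  = expandRed ps cp gp (splits ps) gps [] cols cols [] refl refl gcols eq
      ... | false = expandBlue ps cp gp (splits ps) gps [] cols cols [] refl refl gcols eq

    -- For equal lists of rows and columns the two shuffle signs coincide and their product is a
    -- square, hence 1.
    minor-blocks : ∀ xs → All Good xs →
      minor xs xs ≋ (minor (red xs) (red xs) *P minor (blue xs) (blue xs))
    minor-blocks xs good =
      ≋-trans (splits xs xs good good refl)
        (≋-trans (*P-congʳ _ (shuffleSign-square xs)) (*P-identityˡ _))

-- Tridiagonal determinants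

-- The determinant of a tridiagonal matrix whose opposite off-diagonal entries have product 1.
continuant : List Poly → Poly
continuant []           = 1P
continuant (d ∷ [])     = d
continuant (d ∷ e ∷ ds) = (d *P continuant (e ∷ ds)) -P continuant ds

module Tridiagonal {A : Set} (f : A → A → Poly) where

  open Laplace f

  -- `link` constrains only the product of the two entries beside the diagonal, because the
  -- weighting leaves their common sign open.
  data Chain : List A → Set where
    none : Chain []
    one  : ∀ p → Chain (p ∷ [])
    link : ∀ {p q ps} → (f p q *P f q p) ≋ 1P →
             All (λ z → f p z ≋ [] × f z p ≋ []) ps → Chain (q ∷ ps) → Chain (p ∷ q ∷ ps)

  minor-chain : ∀ {ps} → Chain ps → minor ps ps ≋ continuant (map (λ p → f p p) ps)
  minor-chain none    = ≋-refl
  minor-chain (one p) = solve 1 (λ d → Κ 1P ⊗ (d ⊗ Κ 1P) ⊕ Κ [] ⊜ d) ≋-refl (f p p)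
  minor-chain (link {p} {q} {ps} pq≋1 far chain) = begin
    minor (p ∷ q ∷ ps) (p ∷ q ∷ ps)
      -- Row `p` meets only the columns `p` and `q`. Once row `p` and column `q` are deleted, column
      -- `p` vanishes below row `q`, so that a second expansion leaves a single term.
      ≈⟨ +P-cong (≋-refl {1P *P (f p p *P minor (q ∷ ps) (q ∷ ps))})
           (+P-cong (*P-congˡ (negP 1P) (*P-congˡ (f p q)
               (+P-cong (≋-refl {1P *P (f q p *P minor ps ps)})
                 (expandRow-zeroColumn q ps p [] ps (All.map proj₂ far) refl))))
             (expandRow-zeroRow p (q ∷ ps) (p ∷ q ∷ []) (All.map proj₁ far))) ⟩
    1P *P (f p p *P minor (q ∷ ps) (q ∷ ps))
      +P (negP 1P *P (f p q *P (1P *P (f q p *P minor ps ps) +P [])) +P [])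
      ≈⟨ solve 5 (λ d a b m n →
             Κ 1P ⊗ (d ⊗ m) ⊕ ((⊝ Κ 1P) ⊗ (a ⊗ (Κ 1P ⊗ (b ⊗ n) ⊕ Κ [])) ⊕ Κ [])
               ⊜ d ⊗ m ⊕ ⊝ ((a ⊗ b) ⊗ n)) ≋-refl
           (f p p) (f p q) (f q p) (minor (q ∷ ps) (q ∷ ps)) (minor ps ps) ⟩
    (f p p *P minor (q ∷ ps) (q ∷ ps)) -P ((f p q *P f q p) *P minor ps ps)
      ≈⟨ +P-cong (*P-congˡ (f p p) (minor-chain chain))
           (negP-cong (≋-trans (*P-cong pq≋1 (minor-chain (chain-tail chain))) (*P-identityˡ _))) ⟩
    (f p p *P continuant (map (λ p → f p p) (q ∷ ps))) -P continuant (map (λ p → f p p) ps) ∎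
    where
    open ≋-Reasoning
    chain-tail : ∀ {q ps} → Chain (q ∷ ps) → Chain ps
    chain-tail (one q)          = none
    chain-tail (link _ _ chain) = chain

-- Continuants of degree sequences in terms of the Fibonacci product polynomials

-- U (suc n) is Qp n, and U 0 = 0 realises the convention Q₋₁ = 0.
U : ℕ → Poly
U zero          = []
U (suc zero)    = 1P
U (suc (suc n)) = (X -P constP (+ 3)) *P U (suc n) -P U n

Qp≡U : ∀ n → Qp n ≋ U (suc n)
Qp≡U zero          = ≋-refl
Qp≡U (suc zero)    = solve 1 (λ x → x ⊕ ⊝ Κ (constP (+ 3))
  ⊜ (x ⊕ ⊝ Κ (constP (+ 3))) ⊗ Κ 1P ⊕ ⊝ Κ []) ≋-refl X
Qp≡U (suc (suc n)) =
  +P-cong (*P-congˡ (X -P constP (+ 3)) (Qp≡U (suc n))) (negP-cong (Qp≡U n))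

Pp≡U : ∀ n → Pp n ≋ (U (suc n) +P U n)
Pp≡U zero          = ≋-refl
Pp≡U (suc zero)    = solve 1 (λ x → x ⊕ ⊝ Κ (constP (+ 2))
  ⊜ ((x ⊕ ⊝ Κ (constP (+ 3))) ⊗ Κ 1P ⊕ ⊝ Κ []) ⊕ Κ 1P) ≋-refl X
Pp≡U (suc (suc n)) =
  ≋-trans (+P-cong (*P-congˡ (X -P constP (+ 3)) (Pp≡U (suc n))) (negP-cong (Pp≡U n)))
    (solve 4 (λ t a b c → t ⊗ (a ⊕ b) ⊕ ⊝ (b ⊕ c) ⊜ (t ⊗ a ⊕ ⊝ b) ⊕ (t ⊗ b ⊕ ⊝ c)) ≋-refl
      (X -P constP (+ 3)) (U (suc (suc n))) (U (suc n)) (U n))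

-- Euler's identity for continuants: a string of `m + n` threes is cut after the first `m`, and the
-- correction term removes the two entries next to the cut.
U-+ : ∀ m n → U (suc (m + n)) ≋ ((U (suc m) *P U (suc n)) -P (U m *P U n))
U-+ zero          n = solve 2 (λ a b → a ⊜ Κ 1P ⊗ a ⊕ ⊝ (Κ [] ⊗ b)) ≋-refl (U (suc n)) (U n)
U-+ (suc zero)    n = solve 3 (λ t a b → t ⊗ a ⊕ ⊝ b ⊜ (t ⊗ Κ 1P ⊕ ⊝ Κ []) ⊗ a ⊕ ⊝ (Κ 1P ⊗ b))
  ≋-refl (X -P constP (+ 3)) (U (suc n)) (U n)
U-+ (suc (suc m)) n =
  ≋-trans (+P-cong (*P-congˡ (X -P constP (+ 3)) (U-+ (suc m) n)) (negP-cong (U-+ m n)))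
    (solve 6 (λ t a b c d e → t ⊗ (a ⊗ d ⊕ ⊝ (b ⊗ e)) ⊕ ⊝ (b ⊗ d ⊕ ⊝ (c ⊗ e))
        ⊜ (t ⊗ a ⊕ ⊝ b) ⊗ d ⊕ ⊝ ((t ⊗ b ⊕ ⊝ c) ⊗ e)) ≋-refl
      (X -P constP (+ 3)) (U (suc (suc m))) (U (suc m)) (U m) (U (suc n)) (U n))

shifted : ℕ → Poly
shifted d = X -P constP (+ d)

K : List ℕ → Poly
K ds = continuant (map shifted ds)

-- As functions of `k` both sides satisfy the recursion of `U`; this is the cut of `U-+` with an
-- arbitrary continuation to the right.
K-threes : ∀ k d ds → K (replicate k 3 ++ d ∷ ds) ≋
  ((U (suc k) *P K (d ∷ ds)) -P (U k *P K ds))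
K-threes zero          d ds =
  solve 2 (λ a b → a ⊜ Κ 1P ⊗ a ⊕ ⊝ (Κ [] ⊗ b)) ≋-refl (K (d ∷ ds)) (K ds)
K-threes (suc zero)    d ds =
  solve 3 (λ t a b → t ⊗ a ⊕ ⊝ b ⊜ (t ⊗ Κ 1P ⊕ ⊝ Κ []) ⊗ a ⊕ ⊝ (Κ 1P ⊗ b))
  ≋-refl (X -P constP (+ 3)) (K (d ∷ ds)) (K ds)
K-threes (suc (suc k)) d ds =
  ≋-trans (+P-cong (*P-congˡ (X -P constP (+ 3)) (K-threes (suc k) d ds))
      (negP-cong (K-threes k d ds)))
    (solve 6 (λ t a b c d e → t ⊗ (a ⊗ d ⊕ ⊝ (b ⊗ e)) ⊕ ⊝ (b ⊗ d ⊕ ⊝ (c ⊗ e))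
        ⊜ (t ⊗ a ⊕ ⊝ b) ⊗ d ⊕ ⊝ ((t ⊗ b ⊕ ⊝ c) ⊗ e)) ≋-refl
      (X -P constP (+ 3)) (U (suc (suc k))) (U (suc k)) (U k) (K (d ∷ ds)) (K ds))

-- A continuant is linear in its first entry, with coefficient `K ds`, and `x - 2 = (x - 3) + 1`.
K-two∷ : ∀ ds → K (2 ∷ ds) ≋ (K (3 ∷ ds) +P K ds)
K-two∷ [] = solve 1 (λ x → x ⊕ ⊝ Κ (constP (+ 2)) ⊜ (x ⊕ ⊝ Κ (constP (+ 3))) ⊕ Κ 1P) ≋-refl X
K-two∷ (d ∷ ds) =
  solve 3 (λ x a b → (x ⊕ ⊝ Κ (constP (+ 2))) ⊗ a ⊕ ⊝ b
      ⊜ ((x ⊕ ⊝ Κ (constP (+ 3))) ⊗ a ⊕ ⊝ b) ⊕ a) ≋-refl X (K (d ∷ ds)) (K ds)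

K-two∷threes : ∀ k d ds → K (2 ∷ replicate k 3 ++ d ∷ ds) ≋
  (((U (suc (suc k)) +P U (suc k)) *P K (d ∷ ds)) -P ((U (suc k) +P U k) *P K ds))
K-two∷threes k d ds =
  ≋-trans (K-two∷ (replicate k 3 ++ d ∷ ds))
    (≋-trans (+P-cong (K-threes (suc k) d ds) (K-threes k d ds))
      (solve 5 (λ a b c d e → (a ⊗ d ⊕ ⊝ (b ⊗ e)) ⊕ (b ⊗ d ⊕ ⊝ (c ⊗ e))
          ⊜ (a ⊕ b) ⊗ d ⊕ ⊝ ((b ⊕ c) ⊗ e)) ≋-refl
        (U (suc (suc k))) (U (suc k)) (U k) (K (d ∷ ds)) (K ds)))

K-∷allThrees : ∀ d k → K (d ∷ replicate k 3) ≋ ((shifted d *P U (suc k)) -P U k)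
K-allThrees : ∀ k → K (replicate k 3) ≋ U (suc k)
K-∷allThrees d zero    = solve 1 (λ t → t ⊜ t ⊗ Κ 1P ⊕ ⊝ Κ []) ≋-refl (shifted d)
K-∷allThrees d (suc k) =
  +P-cong (*P-congˡ (shifted d) (K-allThrees (suc k))) (negP-cong (K-allThrees k))
K-allThrees zero    = ≋-refl
K-allThrees (suc k) = K-∷allThrees 3 k

K-threes∷ʳtwo : ∀ k → K (replicate k 3 ∷ʳ 2) ≋ (U (suc (suc k)) +P U (suc k))
K-threes∷ʳtwo k = ≋-trans (K-threes k 2 [])
  (solve 3 (λ x a b → a ⊗ (x ⊕ ⊝ Κ (constP (+ 2))) ⊕ ⊝ (b ⊗ Κ 1P)
      ⊜ ((x ⊕ ⊝ Κ (constP (+ 3))) ⊗ a ⊕ ⊝ b) ⊕ a) ≋-refl X (U (suc k)) (U k))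

K-∷threes∷ʳtwo : ∀ d k → K (d ∷ replicate k 3 ∷ʳ 2) ≋
  ((shifted d *P (U (suc (suc k)) +P U (suc k))) -P (U (suc k) +P U k))
K-∷threes∷ʳtwo d zero    = solve 2 (λ t x →
    t ⊗ (x ⊕ ⊝ Κ (constP (+ 2))) ⊕ ⊝ Κ 1P
      ⊜ t ⊗ (((x ⊕ ⊝ Κ (constP (+ 3))) ⊗ Κ 1P ⊕ ⊝ Κ []) ⊕ Κ 1P) ⊕ ⊝ (Κ 1P ⊕ Κ []))
  ≋-refl (shifted d) X
K-∷threes∷ʳtwo d (suc k) =
  +P-cong (*P-congˡ (shifted d) (K-threes∷ʳtwo (suc k))) (negP-cong (K-threes∷ʳtwo k))

-P-cong : ∀ {p q r s} → p ≋ q → r ≋ s → (p -P r) ≋ (q -P s)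
-P-cong p≋q r≋s = +P-cong p≋q (negP-cong r≋s)

Qp-+ : ∀ m n → Qp (m + n) ≋ ((U (suc m) *P U (suc n)) -P (U m *P U n))
Qp-+ m n = ≋-trans (Qp≡U (m + n)) (U-+ m n)

Pp-suc+ : ∀ m n → Pp (suc m + n) ≋
  ((U (suc (suc m)) +P U (suc m)) *P U (suc n) -P (U (suc m) +P U m) *P U n)
Pp-suc+ m n = ≋-trans (Pp≡U (suc (m + n)))
  (≋-trans (+P-cong (U-+ (suc m) n) (U-+ m n))
    (solve 5 (λ a b c d e → (a ⊗ d ⊕ ⊝ (b ⊗ e)) ⊕ (b ⊗ d ⊕ ⊝ (c ⊗ e))
        ⊜ (a ⊕ b) ⊗ d ⊕ ⊝ ((b ⊕ c) ⊗ e)) ≋-refl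
      (U (suc (suc m))) (U (suc m)) (U m) (U (suc n)) (U n)))

arm-threes : ∀ k d ds {a b} → K (d ∷ ds) ≋ a → K ds ≋ b →
  K (replicate k 3 ++ d ∷ ds) ≋ ((U (suc k) *P a) -P (U k *P b))
arm-threes k d ds a≋ b≋ = ≋-trans (K-threes k d ds)
  (-P-cong (*P-congˡ (U (suc k)) a≋) (*P-congˡ (U k) b≋))

arm-two∷threes : ∀ k d ds {a b} → K (d ∷ ds) ≋ a → K ds ≋ b →
  K (2 ∷ replicate k 3 ++ d ∷ ds) ≋
    (((U (suc (suc k)) +P U (suc k)) *P a) -P ((U (suc k) +P U k) *P b))
arm-two∷threes k d ds a≋ b≋ = ≋-trans (K-two∷threes k d ds)
  (-P-cong (*P-congˡ (U (suc (suc k)) +P U (suc k)) a≋) (*P-congˡ (U (suc k) +P U k) b≋))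

-- The letters give the parities of `r` and `s`, `E` for even and `O` for odd. After the recursion
-- has removed all other values of `U`, each of these identities holds with `U (suc m)`, `U m`,
-- `U (suc n)` and `U n` as independent variables, so the ring solver settles it.
outerEE : ∀ m n → K (2 ∷ replicate m 3 ++ 2 ∷ replicate n 3 ∷ʳ 2) ≋
  ((X -P constP (+ 1)) *P Qp (suc m + suc n) +P Pp (suc m) *P Pp (suc n))
outerEE m n =
  ≋-trans (arm-two∷threes m 2 (replicate n 3 ∷ʳ 2) (K-∷threes∷ʳtwo 2 n) (K-threes∷ʳtwo n))
    (≋-trans
      (solve 5 (λ x a b c d →
          (((x ⊕ ⊝ Κ (constP (+ 3))) ⊗ a ⊕ ⊝ b) ⊕ a) ⊗ ((x ⊕ ⊝ Κ (constP (+ 2))) ⊗ (((x ⊕ ⊝ Κ (constP (+ 3))) ⊗ c ⊕ ⊝ d) ⊕ c) ⊕ ⊝ (c ⊕ d)) ⊕ ⊝ ((a ⊕ b) ⊗ (((x ⊕ ⊝ Κ (constP (+ 3))) ⊗ c ⊕ ⊝ d) ⊕ c))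
          ⊜ (x ⊕ ⊝ Κ 1P) ⊗ (((x ⊕ ⊝ Κ (constP (+ 3))) ⊗ a ⊕ ⊝ b) ⊗ ((x ⊕ ⊝ Κ (constP (+ 3))) ⊗ c ⊕ ⊝ d) ⊕ ⊝ (a ⊗ c)) ⊕ (((x ⊕ ⊝ Κ (constP (+ 3))) ⊗ a ⊕ ⊝ b) ⊕ a) ⊗ (((x ⊕ ⊝ Κ (constP (+ 3))) ⊗ c ⊕ ⊝ d) ⊕ c)) ≋-refl
        X (U (suc m)) (U m) (U (suc n)) (U n))
      (≋-sym (+P-cong (*P-congˡ (X -P constP (+ 1)) (Qp-+ (suc m) (suc n)))
        (*P-cong (Pp≡U (suc m)) (Pp≡U (suc n))))))

innerEE : ∀ m n → K (replicate m 3 ++ 4 ∷ replicate n 3) ≋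
  (Qp (m + suc n) -P Qp m *P Qp n)
innerEE m n =
  ≋-trans (arm-threes m 4 (replicate n 3) (K-∷allThrees 4 n) (K-allThrees n))
    (≋-trans
      (solve 5 (λ x a b c d →
          a ⊗ ((x ⊕ ⊝ Κ (constP (+ 4))) ⊗ c ⊕ ⊝ d) ⊕ ⊝ (b ⊗ c)
          ⊜ (a ⊗ ((x ⊕ ⊝ Κ (constP (+ 3))) ⊗ c ⊕ ⊝ d) ⊕ ⊝ (b ⊗ c)) ⊕ ⊝ (a ⊗ c)) ≋-refl
        X (U (suc m)) (U m) (U (suc n)) (U n))
      (≋-sym (-P-cong (Qp-+ m (suc n)) (*P-cong (Qp≡U m) (Qp≡U n)))))

outerOO : ∀ m n → K (replicate m 3 ++ 2 ∷ replicate n 3) ≋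
  (Qp (m + suc n) +P Qp m *P Qp n)
outerOO m n =
  ≋-trans (arm-threes m 2 (replicate n 3) (K-∷allThrees 2 n) (K-allThrees n))
    (≋-trans
      (solve 5 (λ x a b c d →
          a ⊗ ((x ⊕ ⊝ Κ (constP (+ 2))) ⊗ c ⊕ ⊝ d) ⊕ ⊝ (b ⊗ c)
          ⊜ (a ⊗ ((x ⊕ ⊝ Κ (constP (+ 3))) ⊗ c ⊕ ⊝ d) ⊕ ⊝ (b ⊗ c)) ⊕ (a ⊗ c)) ≋-refl
        X (U (suc m)) (U m) (U (suc n)) (U n))
      (≋-sym (+P-cong (Qp-+ m (suc n)) (*P-cong (Qp≡U m) (Qp≡U n)))))

outerEO : ∀ m n → K (2 ∷ replicate m 3 ++ 2 ∷ replicate n 3) ≋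
  (Pp (suc m + suc n) +P Pp (suc m) *P Qp n)
outerEO m n =
  ≋-trans (arm-two∷threes m 2 (replicate n 3) (K-∷allThrees 2 n) (K-allThrees n))
    (≋-trans
      (solve 5 (λ x a b c d →
          (((x ⊕ ⊝ Κ (constP (+ 3))) ⊗ a ⊕ ⊝ b) ⊕ a) ⊗ ((x ⊕ ⊝ Κ (constP (+ 2))) ⊗ c ⊕ ⊝ d) ⊕ ⊝ ((a ⊕ b) ⊗ c)
          ⊜ ((((x ⊕ ⊝ Κ (constP (+ 3))) ⊗ a ⊕ ⊝ b) ⊕ a) ⊗ ((x ⊕ ⊝ Κ (constP (+ 3))) ⊗ c ⊕ ⊝ d) ⊕ ⊝ ((a ⊕ b) ⊗ c)) ⊕ (((x ⊕ ⊝ Κ (constP (+ 3))) ⊗ a ⊕ ⊝ b) ⊕ a) ⊗ c) ≋-refl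
        X (U (suc m)) (U m) (U (suc n)) (U n))
      (≋-sym (+P-cong (Pp-suc+ m (suc n)) (*P-cong (Pp≡U (suc m)) (Qp≡U n)))))

innerEO-suc : ∀ m n → K (replicate m 3 ++ 4 ∷ replicate n 3 ∷ʳ 2) ≋
  (Pp (suc m + suc n) -P Qp m *P Pp (suc n))
innerEO-suc m n =
  ≋-trans (arm-threes m 4 (replicate n 3 ∷ʳ 2) (K-∷threes∷ʳtwo 4 n) (K-threes∷ʳtwo n))
    (≋-trans
      (solve 5 (λ x a b c d →
          a ⊗ ((x ⊕ ⊝ Κ (constP (+ 4))) ⊗ (((x ⊕ ⊝ Κ (constP (+ 3))) ⊗ c ⊕ ⊝ d) ⊕ c) ⊕ ⊝ (c ⊕ d)) ⊕ ⊝ (b ⊗ (((x ⊕ ⊝ Κ (constP (+ 3))) ⊗ c ⊕ ⊝ d) ⊕ c))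
          ⊜ ((((x ⊕ ⊝ Κ (constP (+ 3))) ⊗ a ⊕ ⊝ b) ⊕ a) ⊗ ((x ⊕ ⊝ Κ (constP (+ 3))) ⊗ c ⊕ ⊝ d) ⊕ ⊝ ((a ⊕ b) ⊗ c)) ⊕ ⊝ (a ⊗ (((x ⊕ ⊝ Κ (constP (+ 3))) ⊗ c ⊕ ⊝ d) ⊕ c))) ≋-refl
        X (U (suc m)) (U m) (U (suc n)) (U n))
      (≋-sym (-P-cong (Pp-suc+ m (suc n)) (*P-cong (Qp≡U m) (Pp≡U (suc n))))))

innerOO-suc-suc : ∀ m n → K (2 ∷ replicate m 3 ++ 4 ∷ replicate n 3 ∷ʳ 2) ≋
  ((X -P constP (+ 1)) *P Qp (suc m + suc n) -P Pp (suc m) *P Pp (suc n))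
innerOO-suc-suc m n =
  ≋-trans (arm-two∷threes m 4 (replicate n 3 ∷ʳ 2) (K-∷threes∷ʳtwo 4 n) (K-threes∷ʳtwo n))
    (≋-trans
      (solve 5 (λ x a b c d →
          (((x ⊕ ⊝ Κ (constP (+ 3))) ⊗ a ⊕ ⊝ b) ⊕ a) ⊗ ((x ⊕ ⊝ Κ (constP (+ 4))) ⊗ (((x ⊕ ⊝ Κ (constP (+ 3))) ⊗ c ⊕ ⊝ d) ⊕ c) ⊕ ⊝ (c ⊕ d)) ⊕ ⊝ ((a ⊕ b) ⊗ (((x ⊕ ⊝ Κ (constP (+ 3))) ⊗ c ⊕ ⊝ d) ⊕ c))
          ⊜ (x ⊕ ⊝ Κ 1P) ⊗ (((x ⊕ ⊝ Κ (constP (+ 3))) ⊗ a ⊕ ⊝ b) ⊗ ((x ⊕ ⊝ Κ (constP (+ 3))) ⊗ c ⊕ ⊝ d) ⊕ ⊝ (a ⊗ c)) ⊕ ⊝ ((((x ⊕ ⊝ Κ (constP (+ 3))) ⊗ a ⊕ ⊝ b) ⊕ a) ⊗ (((x ⊕ ⊝ Κ (constP (+ 3))) ⊗ c ⊕ ⊝ d) ⊕ c))) ≋-refl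
        X (U (suc m)) (U m) (U (suc n)) (U n))
      (≋-sym (-P-cong (*P-congˡ (X -P constP (+ 1)) (Qp-+ (suc m) (suc n)))
        (*P-cong (Pp≡U (suc m)) (Pp≡U (suc n))))))

-- For `s = 1` there is no upper arm: the corner ends the inner path and has degree 3 in place of 4.
innerEO-zero : ∀ m → K (replicate m 3 ++ 3 ∷ []) ≋
  (Pp (suc m + 0) -P Qp m *P Pp 0)
innerEO-zero m =
  ≋-trans (arm-threes m 3 [] ≋-refl ≋-refl)
    (≋-trans
      (solve 3 (λ x a b →
          a ⊗ (x ⊕ ⊝ Κ (constP (+ 3))) ⊕ ⊝ (b ⊗ Κ 1P)
          ⊜ ((((x ⊕ ⊝ Κ (constP (+ 3))) ⊗ a ⊕ ⊝ b) ⊕ a) ⊗ Κ 1P ⊕ ⊝ ((a ⊕ b) ⊗ Κ [])) ⊕ ⊝ (a ⊗ Κ 1P)) ≋-refl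
        X (U (suc m)) (U m))
      (≋-sym (-P-cong (Pp-suc+ m 0) (*P-congʳ (Pp 0) (Qp≡U m)))))

innerOO-suc-zero : ∀ m → K (2 ∷ replicate m 3 ++ 3 ∷ []) ≋
  ((X -P constP (+ 1)) *P Qp (suc m + 0) -P Pp (suc m) *P Pp 0)
innerOO-suc-zero m =
  ≋-trans (arm-two∷threes m 3 [] ≋-refl ≋-refl)
    (≋-trans
      (solve 3 (λ x a b →
          (((x ⊕ ⊝ Κ (constP (+ 3))) ⊗ a ⊕ ⊝ b) ⊕ a) ⊗ (x ⊕ ⊝ Κ (constP (+ 3))) ⊕ ⊝ ((a ⊕ b) ⊗ Κ 1P)
          ⊜ (x ⊕ ⊝ Κ 1P) ⊗ (((x ⊕ ⊝ Κ (constP (+ 3))) ⊗ a ⊕ ⊝ b) ⊗ Κ 1P ⊕ ⊝ (a ⊗ Κ [])) ⊕ ⊝ ((((x ⊕ ⊝ Κ (constP (+ 3))) ⊗ a ⊕ ⊝ b) ⊕ a) ⊗ Κ 1P)) ≋-refl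
        X (U (suc m)) (U m))
      (≋-sym (-P-cong (*P-congˡ (X -P constP (+ 1)) (Qp-+ (suc m) 0))
        (*P-congʳ (Pp 0) (Pp≡U (suc m))))))

innerOO-zero-suc : ∀ n → K (3 ∷ replicate n 3 ∷ʳ 2) ≋
  ((X -P constP (+ 1)) *P Qp (suc n) -P Pp 0 *P Pp (suc n))
innerOO-zero-suc n =
  ≋-trans (K-∷threes∷ʳtwo 3 n)
    (≋-trans
      (solve 3 (λ x c d →
          (x ⊕ ⊝ Κ (constP (+ 3))) ⊗ (((x ⊕ ⊝ Κ (constP (+ 3))) ⊗ c ⊕ ⊝ d) ⊕ c) ⊕ ⊝ (c ⊕ d)
          ⊜ (x ⊕ ⊝ Κ 1P) ⊗ ((x ⊕ ⊝ Κ (constP (+ 3))) ⊗ c ⊕ ⊝ d) ⊕ ⊝ (Κ 1P ⊗ (((x ⊕ ⊝ Κ (constP (+ 3))) ⊗ c ⊕ ⊝ d) ⊕ c))) ≋-refl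
        X (U (suc n)) (U n))
      (≋-sym (-P-cong (*P-congˡ (X -P constP (+ 1)) (Qp≡U (suc n)))
        (*P-congˡ (Pp 0) (Pp≡U (suc n))))))

-- The case of a single tile, where the inner path is one vertex of degree 2.
innerOO-zero-zero : K (2 ∷ []) ≋ ((X -P constP (+ 1)) *P Qp 0 -P Pp 0 *P Pp 0)
innerOO-zero-zero = solve 1 (λ x → x ⊕ ⊝ Κ (constP (+ 2)) ⊜ (x ⊕ ⊝ Κ 1P) ⊗ Κ 1P ⊕ ⊝ (Κ 1P ⊗ Κ 1P))
  ≋-refl X

-- Boolean tests, lists without duplicates and sums with small support

T⇒≡true : ∀ {b} → T b → b ≡ true
T⇒≡true {true} _ = refl

≡true⇒T : ∀ {b} → b ≡ true → T b
≡true⇒T refl = tt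

-- Turns a Boolean test into a decidable equality, which makes the results about `deduplicate`
-- available for `deduplicateᵇ`.
module BooleanEquality {A : Set} (_==_ : A → A → Bool)
  (==⇒≡ : ∀ {x y} → T (x == y) → x ≡ y) (==-refl : ∀ x → T (x == x)) where

  ≡⇒== : ∀ {x y} → x ≡ y → T (x == y)
  ≡⇒== refl = ==-refl _

  _≟_ : DecidableEquality A
  x ≟ y = map′ ==⇒≡ ≡⇒== (T? (x == y))

  deduplicateᵇ≡deduplicate : ∀ xs → deduplicateᵇ _==_ xs ≡ deduplicate _≟_ xs
  deduplicateᵇ≡deduplicate []       = refl
  deduplicateᵇ≡deduplicate (x ∷ xs) = cong (x ∷_) (trans
    (cong (filter (¬? ∘ T? ∘ (x ==_))) (deduplicateᵇ≡deduplicate xs))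
    (Lₚ.filter-≐ (¬? ∘ T? ∘ (x ==_)) (¬? ∘ (x ≟_))
      ((λ ¬T eq → ¬T (≡⇒== eq)) , (λ x≢ t → x≢ (==⇒≡ t))) (deduplicate _≟_ xs)))

  deduplicateᵇ-! : ∀ xs → Unique (deduplicateᵇ _==_ xs)
  deduplicateᵇ-! xs =
    subst Unique (sym (deduplicateᵇ≡deduplicate xs)) (UniqueDecₚ.deduplicate-! _≟_ xs)

  ∈-deduplicateᵇ⁺ : ∀ {x xs} → x ∈ xs → x ∈ deduplicateᵇ _==_ xs
  ∈-deduplicateᵇ⁺ {x} {xs} x∈ =
    subst (x ∈_) (sym (deduplicateᵇ≡deduplicate xs)) (∈-deduplicate⁺ _≟_ x∈)

  ∈-deduplicateᵇ⁻ : ∀ {x} xs → x ∈ deduplicateᵇ _==_ xs → x ∈ xs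
  ∈-deduplicateᵇ⁻ {x} xs = ∈-deduplicate⁻ (λ y z → T? (y == z)) xs

==ℕ⇒≡ : ∀ {m n} → T (m ==ℕ n) → m ≡ n
==ℕ⇒≡ {m} {n} = toWitness {a? = m ℕ.≟ n}

==ℕ-refl : ∀ n → T (n ==ℕ n)
==ℕ-refl n = fromWitness {a? = n ℕ.≟ n} refl

==Pt⇒≡ : ∀ {p q} → T (p ==Pt q) → p ≡ q
==Pt⇒≡ {a , b} {c , d} t with Equivalence.to Boolₚ.T-∧ t
... | a==c , b==d = cong₂ _,_ (==ℕ⇒≡ a==c) (==ℕ⇒≡ b==d)

==Pt-refl : ∀ p → T (p ==Pt p)
==Pt-refl (a , b) = Equivalence.from Boolₚ.T-∧ (==ℕ-refl a , ==ℕ-refl b)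

==E⇒≡ : ∀ {e e′} → T (e ==E e′) → e ≡ e′
==E⇒≡ {p , H} {q , H} t = cong (_, H) (==Pt⇒≡ (proj₁ (Equivalence.to Boolₚ.T-∧ t)))
==E⇒≡ {p , V} {q , V} t = cong (_, V) (==Pt⇒≡ (proj₁ (Equivalence.to Boolₚ.T-∧ t)))
==E⇒≡ {p , H} {q , V} t = contradiction (proj₂ (Equivalence.to (Boolₚ.T-∧ {p ==Pt q}) t)) λ ()
==E⇒≡ {p , V} {q , H} t = contradiction (proj₂ (Equivalence.to (Boolₚ.T-∧ {p ==Pt q}) t)) λ ()

==E-refl : ∀ e → T (e ==E e)
==E-refl (p , H) = Equivalence.from Boolₚ.T-∧ (==Pt-refl p , tt)
==E-refl (p , V) = Equivalence.from Boolₚ.T-∧ (==Pt-refl p , tt)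

module Pt=   = BooleanEquality _==Pt_ ==Pt⇒≡ ==Pt-refl
module Edge= = BooleanEquality _==E_ ==E⇒≡ ==E-refl

fromAllL : ∀ {A : Set} {P : A → Set} {xs} → AllL P xs → All P xs
fromAllL []         = []
fromAllL (px ∷ pxs) = px ∷ fromAllL pxs

sum-zero : ∀ {A : Set} (g : A → ℤ) xs → All (λ z → g z ≡ + 0) xs → sumℤ (map g xs) ≡ + 0
sum-zero g []       []       = refl
sum-zero g (x ∷ xs) (e ∷ es) = cong₂ ℤ._+_ e (sum-zero g xs es)

sum-extract : ∀ {A : Set} (g : A → ℤ) xs y ys →
  sumℤ (map g (xs ++ y ∷ ys)) ≡ g y ℤ.+ sumℤ (map g (xs ++ ys))
sum-extract g []       y ys = refl
sum-extract g (x ∷ xs) y ys =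
  trans (cong (ℤ._+_ (g x)) (sum-extract g xs y ys))
    (trans (sym (ℤₚ.+-assoc (g x) (g y) _))
      (trans (cong (ℤ._+ _) (ℤₚ.+-comm (g x) (g y))) (ℤₚ.+-assoc (g y) (g x) _)))

unique-extract : ∀ {A : Set} xs {y : A} {ys} → Unique (xs ++ y ∷ ys) →
  Unique (xs ++ ys) × All (y ≢_) (xs ++ ys)
unique-extract []       (y≢ ∷ u) = u , y≢
unique-extract (x ∷ xs) (x≢ ∷ u) with unique-extract xs u
... | u′ , y≢ =
  (Allₚ.++⁺ (Allₚ.++⁻ˡ xs x≢) (All.tail (Allₚ.++⁻ʳ xs x≢)) ∷ u′)
  , ((λ y≡x → All.head (Allₚ.++⁻ʳ xs x≢) (sym y≡x)) ∷ y≢)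

∈-extract : ∀ {A : Set} xs {y z : A} {ys} → z ∈ xs ++ y ∷ ys → z ≢ y → z ∈ xs ++ ys
∈-extract xs z∈ z≢y with ∈-++⁻ xs z∈
... | inj₁ z∈xs         = ∈-++⁺ˡ z∈xs
... | inj₂ (here z≡y)   = contradiction z≡y z≢y
... | inj₂ (there z∈ys) = ∈-++⁺ʳ xs z∈ys

∈-insert′ : ∀ {A : Set} xs {y z : A} {ys} → z ∈ xs ++ ys → z ∈ xs ++ y ∷ ys
∈-insert′ xs z∈ = [ ∈-++⁺ˡ , ∈-++⁺ʳ xs ∘ there ]′ (∈-++⁻ xs z∈)

-- This evaluates a sum over a deduplicated list without knowledge of its order: a short list `ys`
-- of members that covers the support suffices. Each element of `ys` is pulled to the front of `xs`
-- and removed from both lists.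
sum-support : ∀ {A : Set} (g : A → ℤ) {xs} → Unique xs → ∀ {ys} → Unique ys → All (_∈ xs) ys →
  (∀ {z} → z ∈ xs → g z ≡ + 0 ⊎ z ∈ ys) → sumℤ (map g xs) ≡ sumℤ (map g ys)
sum-support g {xs} _ {[]} _ _ supp =
  sum-zero g xs (All.tabulate λ z∈ → [ id , (λ ()) ]′ (supp z∈))
sum-support g u {y ∷ ys} (y≢ ∷ uys) (y∈ ∷ ys⊆) supp with ∈-∃++ y∈
... | as , bs , refl with unique-extract as u
...   | u′ , y∉ = trans (sum-extract g as y bs)
  (cong (ℤ._+_ (g y)) (sum-support g u′ uys
    (All.zipWith (λ (z∈ , y≢z) → ∈-extract as z∈ (y≢z ∘ sym)) (ys⊆ , y≢))
    λ z∈ → [ inj₁ , (λ { (here z≡y) → contradiction (sym z≡y) (All.lookup y∉ z∈)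
                       ; (there z∈ys) → inj₂ z∈ys }) ]′ (supp (∈-insert′ as z∈))))

dot-map : ∀ {A : Set} (f g : A → ℤ) xs →
  dot (map f xs) (map g xs) ≡ sumℤ (map (λ z → f z ℤ.* g z) xs)
dot-map f g []       = refl
dot-map f g (x ∷ xs) = cong (ℤ._+_ (f x ℤ.* g x)) (dot-map f g xs)

dot-comm : ∀ as bs → dot as bs ≡ dot bs as
dot-comm []       []       = refl
dot-comm []       (b ∷ bs) = refl
dot-comm (a ∷ as) []       = refl
dot-comm (a ∷ as) (b ∷ bs) = cong₂ ℤ._+_ (ℤₚ.*-comm a b) (dot-comm as bs)

-- Adjacency, colours and the geometry of the L-shape

data Joined : Pt → Pt → Edge → Set where
  east  : ∀ {a b} → Joined (a , b) (suc a , b) ((a , b) , H)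
  west  : ∀ {a b} → Joined (suc a , b) (a , b) ((a , b) , H)
  north : ∀ {a b} → Joined (a , b) (a , suc b) ((a , b) , V)
  south : ∀ {a b} → Joined (a , suc b) (a , b) ((a , b) , V)

joined-unique : ∀ {p z e e′} → Joined p z e → Joined p z e′ → e ≡ e′
joined-unique east  east  = refl
joined-unique west  west  = refl
joined-unique north north = refl
joined-unique south south = refl

endpoints⇒joined : ∀ {p z} e → src e ≡ p → tgt e ≡ z → Joined p z e × Joined z p e
endpoints⇒joined (_ , H) refl refl = east , west
endpoints⇒joined (_ , V) refl refl = north , south

joins⇒joined : ∀ {p z e} → T (joins p z e) → Joined p z e
joins⇒joined {p} {z} {e} t with Equivalence.to (Boolₚ.T-∨ {(src e ==Pt p) ∧ (tgt e ==Pt z)}) t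
... | inj₁ t′ with Equivalence.to (Boolₚ.T-∧ {src e ==Pt p}) t′
...   | s , t″ = proj₁ (endpoints⇒joined e (==Pt⇒≡ s) (==Pt⇒≡ t″))
joins⇒joined {p} {z} {e} t | inj₂ t′ with Equivalence.to (Boolₚ.T-∧ {src e ==Pt z}) t′
...   | s , t″ = proj₂ (endpoints⇒joined e (==Pt⇒≡ s) (==Pt⇒≡ t″))

joined⇒joins : ∀ {p z e} → Joined p z e → T (joins p z e)
joined⇒joins {p} {z} {e} east  = Equivalence.from Boolₚ.T-∨
  (inj₁ (Equivalence.from Boolₚ.T-∧ (==Pt-refl p , ==Pt-refl z)))
joined⇒joins {p} {z} {e} north = Equivalence.from Boolₚ.T-∨
  (inj₁ (Equivalence.from Boolₚ.T-∧ (==Pt-refl p , ==Pt-refl z)))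
joined⇒joins {p} {z} {e} west  = Equivalence.from (Boolₚ.T-∨ {(src e ==Pt p) ∧ (tgt e ==Pt z)})
  (inj₂ (Equivalence.from Boolₚ.T-∧ (==Pt-refl z , ==Pt-refl p)))
joined⇒joins {p} {z} {e} south = Equivalence.from (Boolₚ.T-∨ {(src e ==Pt p) ∧ (tgt e ==Pt z)})
  (inj₂ (Equivalence.from Boolₚ.T-∧ (==Pt-refl z , ==Pt-refl p)))

==ℕ-flip : ∀ k t → ((suc k % 2) ==ℕ (t % 2)) ≡ notB ((k % 2) ==ℕ (t % 2))
==ℕ-flip zero          zero          = refl
==ℕ-flip zero          (suc zero)    = refl
==ℕ-flip (suc zero)    zero          = refl
==ℕ-flip (suc zero)    (suc zero)    = refl
==ℕ-flip (suc (suc k)) t             = ==ℕ-flip k t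
==ℕ-flip zero          (suc (suc t)) = ==ℕ-flip zero t
==ℕ-flip (suc zero)    (suc (suc t)) = ==ℕ-flip 1 t

isBlack-east : ∀ r a b → isBlack r (suc a , b) ≡ notB (isBlack r (a , b))
isBlack-east r a b = ==ℕ-flip (a + b) r

isBlack-north : ∀ r a b → isBlack r (a , suc b) ≡ notB (isBlack r (a , b))
isBlack-north r a b =
  trans (cong (λ k → (k % 2) ==ℕ (r % 2)) (ℕₚ.+-suc a b)) (==ℕ-flip (a + b) r)

notB-involutive : ∀ b → notB (notB b) ≡ b
notB-involutive true  = refl
notB-involutive false = refl

isBlack-joined : ∀ r {p z e} → Joined p z e → isBlack r z ≡ notB (isBlack r p)
isBlack-joined r (east  {a} {b}) = isBlack-east r a b
isBlack-joined r (north {a} {b}) = isBlack-north r a b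
isBlack-joined r (west  {a} {b}) = sym (trans (cong notB (isBlack-east r a b)) (notB-involutive _))
isBlack-joined r (south {a} {b}) = sym (trans (cong notB (isBlack-north r a b)) (notB-involutive _))

sign-square : ∀ {x} → Sign x → x ℤ.* x ≡ + 1
sign-square plus  = refl
sign-square minus = refl

sign-* : ∀ {x y} → Sign x → Sign y → Sign (x ℤ.* y)
sign-* plus  plus  = plus
sign-* plus  minus = minus
sign-* minus plus  = minus
sign-* minus minus = plus

countNeg : List ℤ → ℕ
countNeg xs = length (filterᵇ (λ x → ⌊ x ℤ.≟ minusOne ⌋) xs)

numNeg≡countNeg : ∀ w es → numNeg w es ≡ countNeg (map w es)
numNeg≡countNeg w []       = refl
numNeg≡countNeg w (e ∷ es) with ⌊ w e ℤ.≟ minusOne ⌋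
... | true  = cong suc (numNeg≡countNeg w es)
... | false = numNeg≡countNeg w es

-- With an odd number of negative edges the two paths between opposite corners of a tile
-- have opposite signs.
square-cancels : ∀ {x₁ x₂ x₃ x₄} → Sign x₁ → Sign x₂ → Sign x₃ → Sign x₄ →
  countNeg (x₁ ∷ x₂ ∷ x₃ ∷ x₄ ∷ []) % 2 ≡ 1 →
  (x₁ ℤ.* x₄ ℤ.+ (x₃ ℤ.* x₂ ℤ.+ + 0) ≡ + 0) × (x₁ ℤ.* x₃ ℤ.+ (x₄ ℤ.* x₂ ℤ.+ + 0) ≡ + 0)
square-cancels plus  plus  plus  minus _ = refl , refl
square-cancels plus  plus  minus plus  _ = refl , refl
square-cancels plus  minus plus  plus  _ = refl , refl
square-cancels plus  minus minus minus _ = refl , refl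
square-cancels minus plus  plus  plus  _ = refl , refl
square-cancels minus plus  minus minus _ = refl , refl
square-cancels minus minus plus  minus _ = refl , refl
square-cancels minus minus minus plus  _ = refl , refl
square-cancels plus  plus  plus  plus  ()
square-cancels plus  plus  minus minus ()
square-cancels plus  minus plus  minus ()
square-cancels plus  minus minus plus  ()
square-cancels minus plus  plus  minus ()
square-cancels minus plus  minus plus  ()
square-cancels minus minus plus  plus  ()
square-cancels minus minus minus minus ()

data Step : Pt → Pt → Set where
  right : ∀ {a b} → Step (a , b) (suc (suc a) , b)
  up    : ∀ {a b} → Step (a , b) (a , suc (suc b))

module Grid (r′ s′ : ℕ) where

  r s : ℕ
  r = suc r′
  s = suc s′

  -- The last component says that the object lies in the horizontal arm or in the vertical one,
  -- whose tiles have first coordinate `r′`. Tiles and vertical edges are named by their lower end,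
  -- so in the horizontal arm they have height 0, whereas vertices and horizontal edges there have
  -- height 0 or 1.
  Vertex Tile Hor Ver : ℕ → ℕ → Set
  Vertex a b = a ≤ r  × b ≤ s  × (b ≤ 1 ⊎ r′ ≤ a)
  Tile   a b = a ≤ r′ × b ≤ s′ × (b ≤ 0 ⊎ r′ ≤ a)
  Hor    a b = a ≤ r′ × b ≤ s  × (b ≤ 1 ⊎ r′ ≤ a)
  Ver    a b = a ≤ r  × b ≤ s′ × (b ≤ 0 ⊎ r′ ≤ a)

  IsVertex : Pt → Set
  IsVertex (a , b) = Vertex a b

  IsEdge : Edge → Set
  IsEdge ((a , b) , H) = Hor a b
  IsEdge ((a , b) , V) = Ver a b

  tile⇒∈ : ∀ a b → Tile a b → (a , b) ∈ tilesL r s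
  tile⇒∈ a b       (a≤ , b≤ , inj₁ z≤n)  = ∈-++⁺ˡ (∈-applyUpTo⁺ (λ i → (i , 0)) (s≤s a≤))
  tile⇒∈ a zero    (a≤ , b≤ , inj₂ r′≤a) = ∈-++⁺ˡ (∈-applyUpTo⁺ (λ i → (i , 0)) (s≤s a≤))
  tile⇒∈ a (suc j) (a≤ , b≤ , inj₂ r′≤a) rewrite ℕₚ.≤-antisym a≤ r′≤a =
    ∈-++⁺ʳ (applyUpTo (λ i → (i , 0)) r) (∈-applyUpTo⁺ (λ j → (r′ , suc j)) b≤)

  ∈⇒tile : ∀ {a b} → (a , b) ∈ tilesL r s → Tile a b
  ∈⇒tile t∈ with ∈-++⁻ (applyUpTo (λ i → (i , 0)) r) t∈
  ... | inj₁ t∈₁ with ∈-applyUpTo⁻ (λ i → (i , 0)) t∈₁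
  ...   | i , s≤s i≤ , refl = i≤ , z≤n , inj₁ z≤n
  ∈⇒tile t∈ | inj₂ t∈₂ with ∈-applyUpTo⁻ (λ j → (r′ , suc j)) t∈₂
  ...   | j , j< , refl = ℕₚ.≤-refl , j< , inj₂ ℕₚ.≤-refl

  -- A horizontal edge above the bottom line is taken as the top of the tile below it, and a
  -- vertical edge on the line `r` as the right side of a tile; all others are a bottom or a left
  -- side.
  edge⇒tile : ∀ e → IsEdge e → ∃[ t ] t ∈ tilesL r s × e ∈ tileEdges t
  edge⇒tile ((a , zero) , H) (a≤ , _ , _) =
    (a , 0) , tile⇒∈ a 0 (a≤ , z≤n , inj₁ z≤n) , here refl
  edge⇒tile ((a , suc b) , H) (a≤ , s≤s b≤ , c) =
    (a , b) , tile⇒∈ a b (a≤ , b≤ , [ inj₁ ∘ ℕₚ.≤-pred , inj₂ ]′ c) , there (here refl)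
  edge⇒tile ((a , b) , V) (a≤ , b≤ , c) with ℕₚ.m≤n⇒m<n∨m≡n a≤
  ... | inj₁ (s≤s a≤r′) =
    (a , b) , tile⇒∈ a b (a≤r′ , b≤ , c) , there (there (here refl))
  ... | inj₂ refl =
    (r′ , b) , tile⇒∈ r′ b (ℕₚ.≤-refl , b≤ , inj₂ ℕₚ.≤-refl) , there (there (there (here refl)))

  edge⇒∈ : ∀ {e} → IsEdge e → e ∈ edgesL r s
  edge⇒∈ {e} ie with edge⇒tile e ie
  ... | t , t∈ , e∈ = Edge=.∈-deduplicateᵇ⁺ (∈-concatMap⁺ tileEdges (lose t∈ e∈))

  tile-edges : ∀ {a b} → Tile a b → All IsEdge (tileEdges (a , b))
  tile-edges (a≤ , b≤ , c) =
      (a≤ , ℕₚ.m≤n⇒m≤1+n b≤ , [ inj₁ ∘ ℕₚ.m≤n⇒m≤1+n , inj₂ ]′ c)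
    ∷ (a≤ , s≤s b≤ , [ inj₁ ∘ s≤s , inj₂ ]′ c)
    ∷ (ℕₚ.m≤n⇒m≤1+n a≤ , b≤ , c)
    ∷ (s≤s a≤ , b≤ , [ inj₁ , inj₂ ∘ ℕₚ.m≤n⇒m≤1+n ]′ c)
    ∷ []

  tile-corners : ∀ {a b} → Tile a b → All IsVertex (tileCorners (a , b))
  tile-corners (a≤ , b≤ , c) =
      (ℕₚ.m≤n⇒m≤1+n a≤ , ℕₚ.m≤n⇒m≤1+n b≤ , [ inj₁ ∘ ℕₚ.m≤n⇒m≤1+n , inj₂ ]′ c)
    ∷ (s≤s a≤ , ℕₚ.m≤n⇒m≤1+n b≤ , [ inj₁ ∘ ℕₚ.m≤n⇒m≤1+n , inj₂ ∘ ℕₚ.m≤n⇒m≤1+n ]′ c)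
    ∷ (ℕₚ.m≤n⇒m≤1+n a≤ , s≤s b≤ , [ inj₁ ∘ s≤s , inj₂ ]′ c)
    ∷ (s≤s a≤ , s≤s b≤ , [ inj₁ ∘ s≤s , inj₂ ∘ ℕₚ.m≤n⇒m≤1+n ]′ c)
    ∷ []

  ∈⇒edge : ∀ {e} → e ∈ edgesL r s → IsEdge e
  ∈⇒edge e∈
    with find (∈-concatMap⁻ tileEdges {xs = tilesL r s}
           (Edge=.∈-deduplicateᵇ⁻ (concatMap tileEdges (tilesL r s)) e∈))
  ... | t , t∈ , e∈t = All.lookup (tile-edges (∈⇒tile t∈)) e∈t

  ∈⇒vertex : ∀ {p} → p ∈ verticesL r s → IsVertex p
  ∈⇒vertex p∈
    with find (∈-concatMap⁻ tileCorners {xs = tilesL r s}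
           (Pt=.∈-deduplicateᵇ⁻ (concatMap tileCorners (tilesL r s)) p∈))
  ... | t , t∈ , p∈t = All.lookup (tile-corners (∈⇒tile t∈)) p∈t

  joined-corner : ∀ {p z e} t → Joined p z e → e ∈ tileEdges t → z ∈ tileCorners t
  joined-corner t east  (here refl)         = there (here refl)
  joined-corner t west  (here refl)         = here refl
  joined-corner t east  (there (here refl)) = there (there (there (here refl)))
  joined-corner t west  (there (here refl)) = there (there (here refl))
  joined-corner t east  (there (there (there (there ()))))
  joined-corner t west  (there (there (there (there ()))))
  joined-corner t north (there (there (here refl)))         = there (there (here refl))
  joined-corner t south (there (there (here refl)))         = here refl
  joined-corner t north (there (there (there (here refl)))) = there (there (there (here refl)))
  joined-corner t south (there (there (there (here refl)))) = there (here refl)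

  joined⇒∈ : ∀ {p z e} → Joined p z e → IsEdge e → z ∈ verticesL r s
  joined⇒∈ {e = e} j ie with edge⇒tile e ie
  ... | t , t∈ , e∈ = Pt=.∈-deduplicateᵇ⁺ (∈-concatMap⁺ tileCorners (lose t∈ (joined-corner t j e∈)))

  Black : Pt → Set
  Black p = isBlack r p ≡ true

  joined-white : ∀ {p z e} → Black p → Joined p z e → IsEdge e → z ∈ whiteL r s
  joined-white {p} {z} bp j ie =
    ∈-filter⁺ (T? ∘ λ p → notB (isBlack r p)) (joined⇒∈ j ie)
      (≡true⇒T (trans (cong notB (trans (isBlack-joined r j) (cong notB bp))) refl))

  -- Here a + 1 = r - 1, whereas black vertices satisfy a + b ≡ r (mod 2).
  ¬black-diagonal : ∀ {a} → suc a ≡ r′ → ¬ Black (a , 1)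
  ¬black-diagonal {a} refl ba
    with () ← trans (sym ba)
      (trans (cong (λ k → (k % 2) ==ℕ (suc (suc a) % 2)) (ℕₚ.+-comm a 1))
        (trans (==ℕ-flip a a) (cong notB (T⇒≡true (==ℕ-refl (a % 2))))))

-- Entries of the Gram matrix of the rows of B

module Gram (r′ s′ : ℕ) (w : Weighting) (kast : IsKasteleyn (suc r′) (suc s′) w) where

  open Grid r′ s′

  sign : ∀ {e} → IsEdge e → Sign (w e)
  sign ie = All.lookup (fromAllL (proj₁ kast)) (edge⇒∈ ie)

  tile-odd : ∀ {a b} → Tile a b → countNeg (map w (tileEdges (a , b))) % 2 ≡ 1
  tile-odd {a} {b} t = trans
    (cong (_% 2) (sym (numNeg≡countNeg w (tileEdges (a , b)))))
    (proj₁ (All.lookup (fromAllL (proj₂ kast)) (∈-++⁺ˡ (∈-map⁺ tileEdges (tile⇒∈ a b t)))) refl)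

  entry : Pt → Pt → ℤ
  entry = entryB r s w

  -- Two grid points are joined by at most one edge, and `edgesL` lists it once, so the sum has a
  -- single term.
  entry-edge : ∀ {p z e} → Joined p z e → IsEdge e → entry p z ≡ w e
  entry-edge {p} {z} {e} j ie = trans
    (sum-support w (Uniqueₚ.filter⁺ (T? ∘ joins p z) (Edge=.deduplicateᵇ-! (concatMap tileEdges (tilesL r s))))
      {e ∷ []} ([] ∷ []) (∈-filter⁺ (T? ∘ joins p z) (edge⇒∈ ie) (joined⇒joins j) ∷ [])
      λ e′∈ → inj₂ (here (joined-unique
        (joins⇒joined (proj₂ (∈-filter⁻ (T? ∘ joins p z) {xs = edgesL r s} e′∈))) j)))
    (ℤₚ.+-identityʳ (w e))

  entry-cases : ∀ p z → entry p z ≡ + 0 ⊎ ∃[ e ] Joined p z e × IsEdge e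
  entry-cases p z with filterᵇ (joins p z) (edgesL r s) in eq
  ... | []     = inj₁ refl
  ... | e ∷ es with ∈-filter⁻ (T? ∘ joins p z) {xs = edgesL r s} (subst (e ∈_) (sym eq) (here refl))
  ...   | e∈ , t = inj₂ (e , joins⇒joined t , ∈⇒edge e∈)

  row : Pt → List ℤ
  row p = map (entry p) (whiteL r s)

  gram : Pt → Pt → ℤ
  gram p q = dot (row p) (row q)

  CommonNeighbour : Pt → Pt → Pt → Set
  CommonNeighbour p q z =
    (∃[ e ] Joined p z e × IsEdge e) × (∃[ e′ ] Joined q z e′ × IsEdge e′)

  summand-cases : ∀ p q z → entry p z ℤ.* entry q z ≡ + 0 ⊎ CommonNeighbour p q z
  summand-cases p q z with entry-cases p z | entry-cases q z
  ... | inj₁ eq | _       = inj₁ (cong (ℤ._* entry q z) eq)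
  ... | inj₂ _  | inj₁ eq = inj₁ (trans (cong (entry p z ℤ.*_) eq) (ℤₚ.*-zeroʳ (entry p z)))
  ... | inj₂ j  | inj₂ j′ = inj₂ (j , j′)

  gram-cases : ∀ p q → gram p q ≡ + 0 ⊎ ∃[ z ] CommonNeighbour p q z
  gram-cases p q rewrite dot-map (entry p) (entry q) (whiteL r s) = scan (whiteL r s)
    where
    scan : ∀ zs → sumℤ (map (λ z → entry p z ℤ.* entry q z) zs) ≡ + 0 ⊎ ∃[ z ] CommonNeighbour p q z
    scan []       = inj₁ refl
    scan (z ∷ zs) with summand-cases p q z | scan zs
    ... | inj₂ c  | _       = inj₂ (z , c)
    ... | inj₁ _  | inj₂ c  = inj₂ c
    ... | inj₁ e₁ | inj₁ e₂ = inj₁ (cong₂ ℤ._+_ e₁ e₂)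

  white-! : Unique (whiteL r s)
  white-! = Uniqueₚ.filter⁺ (T? ∘ λ p → notB (isBlack r p)) 
    (Pt=.deduplicateᵇ-! (concatMap tileCorners (tilesL r s)))

  -- Every common neighbour is adjacent to the black `p`, hence white, hence among the columns over
  -- which the dot product runs.
  gram-support : ∀ {p q zs} → Black p → Unique zs → All (CommonNeighbour p q) zs →
    (∀ {z} → CommonNeighbour p q z → z ∈ zs) →
    gram p q ≡ sumℤ (map (λ z → entry p z ℤ.* entry q z) zs)
  gram-support {p} {q} bp u common supp =
    trans (dot-map (entry p) (entry q) (whiteL r s))
      (sum-support _ white-! u
        (All.map (λ { ((e , j , ie) , _) → joined-white bp j ie }) common)
        λ {z} _ → [ inj₁ , inj₂ ∘ supp ]′ (summand-cases p q z))

  -- The midpoint is the only common neighbour, so the entry is a product of two signs; by symmetry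
  -- the product of both entries is its square.
  gram-step : ∀ {p q} → Step p q → Black p → IsVertex p → IsVertex q →
    gram p q ℤ.* gram q p ≡ + 1
  gram-step {p} {q} st bp vp vq =
    trans (cong (gram p q ℤ.*_) (dot-comm (row q) (row p))) (sign-square (gram-sign st bp vp vq))
    where
    one : ∀ {p q z e e′} → Black p → Joined p z e → IsEdge e → Joined q z e′ → IsEdge e′ →
      (∀ {z′} → CommonNeighbour p q z′ → z′ ∈ z ∷ []) → Sign (gram p q)
    one bp j ie j′ ie′ supp = subst Sign
      (sym (trans (gram-support bp ([] ∷ []) (((_ , j , ie) , (_ , j′ , ie′)) ∷ []) supp)
        (trans (ℤₚ.+-identityʳ _) (cong₂ ℤ._*_ (entry-edge j ie) (entry-edge j′ ie′)))))
      (sign-* (sign ie) (sign ie′))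

    gram-sign : ∀ {p q} → Step p q → Black p → IsVertex p → IsVertex q → Sign (gram p q)
    gram-sign (right {a} {b}) bp (_ , b≤ , c) (s≤s 1+a≤ , _ , _) =
      one bp east (ℕₚ.≤-trans (ℕₚ.n≤1+n a) 1+a≤ , b≤ , c) west
        (1+a≤ , b≤ , [ inj₁ , inj₂ ∘ ℕₚ.m≤n⇒m≤1+n ]′ c) supp
      where
      supp : ∀ {z} → CommonNeighbour (a , b) (suc (suc a) , b) z → z ∈ (suc a , b) ∷ []
      supp ((_ , east  , _) , (_ , _ , _)) = here refl
      supp ((_ , west  , _) , (_ , () , _))
      supp ((_ , north , _) , (_ , () , _))
      supp ((_ , south , _) , (_ , () , _))
    gram-sign (up {a} {b}) bp (a≤ , _ , _) (_ , s≤s 1+b≤ , c) =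
      one bp north (a≤ , ℕₚ.≤-trans (ℕₚ.n≤1+n b) 1+b≤ , inj₂ r′≤a) south (a≤ , 1+b≤ , inj₂ r′≤a) supp
      where
      -- The upper vertex has height at least 2, which places it in the vertical arm.
      r′≤a : r′ ≤ a
      r′≤a = [ (λ { (s≤s ()) }) , id ]′ c
      supp : ∀ {z} → CommonNeighbour (a , b) (a , suc (suc b)) z → z ∈ (a , suc b) ∷ []
      supp ((_ , north , _) , (_ , _ , _)) = here refl
      supp ((_ , south , _) , (_ , () , _))
      supp ((_ , east  , _) , (_ , () , _))
      supp ((_ , west  , _) , (_ , () , _))

  private
    two : ∀ {p q z e₁ e₂ z′ e₃ e₄} → Black p → z ≢ z′ →
      Joined p z e₁ → IsEdge e₁ → Joined q z e₂ → IsEdge e₂ →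
      Joined p z′ e₃ → IsEdge e₃ → Joined q z′ e₄ → IsEdge e₄ →
      (∀ {y} → CommonNeighbour p q y → y ∈ z ∷ z′ ∷ []) →
      gram p q ≡ w e₁ ℤ.* w e₂ ℤ.+ (w e₃ ℤ.* w e₄ ℤ.+ + 0)
    two bp z≢z′ j₁ i₁ j₂ i₂ j₃ i₃ j₄ i₄ supp =
      trans (gram-support bp ((z≢z′ ∷ []) ∷ [] ∷ [])
          (((_ , j₁ , i₁) , (_ , j₂ , i₂)) ∷ ((_ , j₃ , i₃) , (_ , j₄ , i₄)) ∷ []) supp)
        (cong₂ ℤ._+_ (cong₂ ℤ._*_ (entry-edge j₁ i₁) (entry-edge j₂ i₂))
          (cong (ℤ._+ + 0) (cong₂ ℤ._*_ (entry-edge j₃ i₃) (entry-edge j₄ i₄))))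

  gram-diagonal : ∀ {a b} → Tile a b → Black (a , b) → gram (a , b) (suc a , suc b) ≡ + 0
  -- In the order of `tileEdges`, `i₁` to `i₄` are the bottom, top, left and right side.
  gram-diagonal {a} {b} t bp with tile-edges t
  ... | i₁ ∷ i₂ ∷ i₃ ∷ i₄ ∷ [] = trans
    (two bp (λ ()) east i₁ south i₄ north i₃ west i₂ supp)
    (proj₁ (square-cancels (sign i₁) (sign i₂) (sign i₃) (sign i₄) (tile-odd t)))
    where
    supp : ∀ {z} → CommonNeighbour (a , b) (suc a , suc b) z → z ∈ (suc a , b) ∷ (a , suc b) ∷ []
    supp ((_ , east  , _) , _) = here refl
    supp ((_ , north , _) , _) = there (here refl)
    supp ((_ , west  , _) , (_ , () , _))
    supp ((_ , south , _) , (_ , () , _))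

  gram-antidiagonal : ∀ {a b} → Tile a b → Black (suc a , b) → gram (suc a , b) (a , suc b) ≡ + 0
  gram-antidiagonal {a} {b} t bp with tile-edges t
  ... | i₁ ∷ i₂ ∷ i₃ ∷ i₄ ∷ [] = trans
    (two bp (λ ()) west i₁ south i₃ north i₄ east i₂ supp)
    (proj₂ (square-cancels (sign i₁) (sign i₂) (sign i₃) (sign i₄) (tile-odd t)))
    where
    supp : ∀ {z} → CommonNeighbour (suc a , b) (a , suc b) z → z ∈ (a , b) ∷ (suc a , suc b) ∷ []
    supp ((_ , west  , _) , _) = here refl
    supp ((_ , north , _) , _) = there (here refl)
    supp ((_ , east  , _) , (_ , () , _))
    supp ((_ , south , _) , (_ , () , _))

  -- A step to the right followed by one up misses a tile only when it passes through the inner turn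
  -- `(r′ , 1)`. Then it starts at a neighbour of a black vertex, which contradicts the blackness of
  -- `(a , b)`.
  lower-tile : ∀ {a b} → Black (a , b) → Hor a b → Ver (suc a) b → Tile a b
  lower-tile bp (a≤ , _ , inj₂ r′≤a) (_ , b≤ , _)        = a≤ , b≤ , inj₂ r′≤a
  lower-tile bp (a≤ , _ , inj₁ _)    (_ , b≤ , inj₁ b≤0) = a≤ , b≤ , inj₁ b≤0
  lower-tile bp (a≤ , _ , inj₁ z≤n)  (_ , b≤ , inj₂ _)   = a≤ , b≤ , inj₁ z≤n
  lower-tile bp (a≤ , _ , inj₁ (s≤s z≤n)) (_ , b≤ , inj₂ r′≤1+a) with ℕₚ.m≤n⇒m<n∨m≡n a≤
  ... | inj₁ a<   = contradiction bp (¬black-diagonal (ℕₚ.≤-antisym a< r′≤1+a))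
  ... | inj₂ refl = a≤ , b≤ , inj₂ ℕₚ.≤-refl

  upper-tile : ∀ {a b} → Hor a (suc b) → Tile a b
  upper-tile (a≤ , s≤s b≤ , c) = a≤ , b≤ , [ inj₁ ∘ ℕₚ.≤-pred , inj₂ ]′ c

  left-tile : ∀ {a b} → Hor a b → Ver a b → Tile a b
  left-tile (a≤ , _ , _) (_ , b≤ , c) = a≤ , b≤ , c

  gram-sym : ∀ p q → gram p q ≡ gram q p
  gram-sym p q = dot-comm (row p) (row q)

  -- A nonzero entry needs a common neighbour. Of the sixteen pairs of directions towards it, equal
  -- ones give `p = q`, opposite ones a step, and perpendicular ones two sides of a tile, where the
  -- two paths cancel.
  gram-zero : ∀ {p q} → Black p → Black q → p ≢ q → ¬ Step p q → ¬ Step q p → gram p q ≡ + 0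
  gram-zero {p} {q} bp bq p≢q ¬pq ¬qp with gram-cases p q
  ... | inj₁ eq = eq
  ... | inj₂ (_ , (_ , east  , _) , (_ , east  , _)) = contradiction refl p≢q
  ... | inj₂ (_ , (_ , west  , _) , (_ , west  , _)) = contradiction refl p≢q
  ... | inj₂ (_ , (_ , north , _) , (_ , north , _)) = contradiction refl p≢q
  ... | inj₂ (_ , (_ , south , _) , (_ , south , _)) = contradiction refl p≢q
  ... | inj₂ (_ , (_ , east  , _) , (_ , west  , _)) = contradiction right ¬pq
  ... | inj₂ (_ , (_ , west  , _) , (_ , east  , _)) = contradiction right ¬qp
  ... | inj₂ (_ , (_ , north , _) , (_ , south , _)) = contradiction up ¬pq
  ... | inj₂ (_ , (_ , south , _) , (_ , north , _)) = contradiction up ¬qp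
  ... | inj₂ (_ , (_ , east  , i) , (_ , south , j)) = gram-diagonal (lower-tile bp i j) bp
  ... | inj₂ (_ , (_ , north , i) , (_ , west  , j)) = gram-diagonal (upper-tile j) bp
  ... | inj₂ (_ , (_ , south , i) , (_ , east  , j)) =
    trans (gram-sym p q) (gram-diagonal (lower-tile bq j i) bq)
  ... | inj₂ (_ , (_ , west  , i) , (_ , north , j)) =
    trans (gram-sym p q) (gram-diagonal (upper-tile i) bq)
  ... | inj₂ (_ , (_ , west  , i) , (_ , south , j)) = gram-antidiagonal (left-tile i j) bp
  ... | inj₂ (_ , (_ , north , i) , (_ , east  , j)) = gram-antidiagonal (upper-tile j) bp
  ... | inj₂ (_ , (_ , south , i) , (_ , west  , j)) =
    trans (gram-sym p q) (gram-antidiagonal (left-tile j i) bq)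
  ... | inj₂ (_ , (_ , east  , i) , (_ , north , j)) =
    trans (gram-sym p q) (gram-antidiagonal (upper-tile i) bq)

  -- Degrees of the black vertices

  Neighbour : Pt → Pt → Set
  Neighbour p z = ∃[ e ] Joined p z e × IsEdge e

  -- Each neighbour contributes the square of a sign.
  gram-degree : ∀ p zs → Black p → Unique zs → All (Neighbour p) zs →
    (∀ {z} → Neighbour p z → z ∈ zs) → gram p p ≡ + length zs
  gram-degree p zs bp u nbrs supp =
    trans (gram-support bp u (All.map (λ n → n , n) nbrs) (supp ∘ proj₁)) (count nbrs)
    where
    count : ∀ {zs} → All (Neighbour p) zs →
      sumℤ (map (λ z → entry p z ℤ.* entry p z) zs) ≡ + length zs
    count []                   = refl
    count ((e , j , ie) ∷ nbrs) = cong₂ ℤ._+_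
      (trans (cong₂ ℤ._*_ (entry-edge j ie) (entry-edge j ie)) (sign-square (sign ie)))
      (count nbrs)

  HasDegree : Pt → ℕ → Set
  HasDegree p d = gram p p ≡ + d

  degree-origin : Black (0 , 0) → HasDegree (0 , 0) 2
  degree-origin bp = gram-degree (0 , 0)
    ((1 , 0) ∷ (0 , 1) ∷ []) bp (((λ ()) ∷ []) ∷ [] ∷ [])
    ((_ , east , z≤n , z≤n , inj₁ z≤n) ∷ (_ , north , z≤n , z≤n , inj₁ z≤n) ∷ [])
    λ { (_ , east , _) → here refl ; (_ , north , _) → there (here refl) }

  degree-bottom : ∀ {a} → suc a ≤ r′ → Black (suc a , 0) → HasDegree (suc a , 0) 3
  degree-bottom {a} a< bp = gram-degree (suc a , 0)
    ((a , 0) ∷ (suc (suc a) , 0) ∷ (suc a , 1) ∷ []) bp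
    (((λ ()) ∷ (λ ()) ∷ []) ∷ ((λ ()) ∷ []) ∷ [] ∷ [])
    ( (_ , west , ℕₚ.<⇒≤ a< , z≤n , inj₁ z≤n)
    ∷ (_ , east , a< , z≤n , inj₁ z≤n)
    ∷ (_ , north , ℕₚ.m≤n⇒m≤1+n a< , z≤n , inj₁ z≤n) ∷ [])
    λ { (_ , west , _) → here refl ; (_ , east , _) → there (here refl)
      ; (_ , north , _) → there (there (here refl)) }

  degree-corner : Black (r , 0) → HasDegree (r , 0) 2
  degree-corner bp = gram-degree (r , 0)
    ((r′ , 0) ∷ (r , 1) ∷ []) bp (((λ ()) ∷ []) ∷ [] ∷ [])
    ( (_ , west , ℕₚ.≤-refl , z≤n , inj₁ z≤n)
    ∷ (_ , north , ℕₚ.≤-refl , z≤n , inj₁ z≤n) ∷ [])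
    λ { (_ , west , _) → here refl ; (_ , north , _) → there (here refl)
      ; (_ , east , r≤r′ , _) → contradiction r≤r′ ℕₚ.1+n≰n }

  degree-right : ∀ {b} → suc b ≤ s′ → Black (r , suc b) → HasDegree (r , suc b) 3
  degree-right {b} b< bp = gram-degree (r , suc b)
    ((r , b) ∷ (r , suc (suc b)) ∷ (r′ , suc b) ∷ []) bp
    (((λ ()) ∷ (λ ()) ∷ []) ∷ ((λ ()) ∷ []) ∷ [] ∷ [])
    ( (_ , south , ℕₚ.≤-refl , ℕₚ.<⇒≤ b< , inj₂ (ℕₚ.n≤1+n r′))
    ∷ (_ , north , ℕₚ.≤-refl , b< , inj₂ (ℕₚ.n≤1+n r′))
    ∷ (_ , west , ℕₚ.≤-refl , ℕₚ.m≤n⇒m≤1+n b< , inj₂ ℕₚ.≤-refl) ∷ [])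
    λ { (_ , south , _) → here refl ; (_ , north , _) → there (here refl)
      ; (_ , west , _) → there (there (here refl))
      ; (_ , east , r≤r′ , _) → contradiction r≤r′ ℕₚ.1+n≰n }

  degree-right-end : ∀ {b} → b ≡ s′ → Black (r , suc b) → HasDegree (r , suc b) 2
  degree-right-end refl bp = gram-degree (r , s)
    ((r , s′) ∷ (r′ , s) ∷ []) bp (((λ ()) ∷ []) ∷ [] ∷ [])
    ( (_ , south , ℕₚ.≤-refl , ℕₚ.≤-refl , inj₂ (ℕₚ.n≤1+n r′))
    ∷ (_ , west , ℕₚ.≤-refl , ℕₚ.≤-refl , inj₂ ℕₚ.≤-refl) ∷ [])
    λ { (_ , south , _) → here refl ; (_ , west , _) → there (here refl)
      ; (_ , north , _ , s≤s′ , _) → contradiction s≤s′ ℕₚ.1+n≰n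
      ; (_ , east , r≤r′ , _) → contradiction r≤r′ ℕₚ.1+n≰n }

  -- Ver a 1 holds exactly if (a , 1) has a neighbour above it.
  degree-top : ∀ {a} → suc a ≤ r′ → ¬ Ver (suc a) 1 → Black (suc a , 1) → HasDegree (suc a , 1) 3
  degree-top {a} a< ¬v bp = gram-degree (suc a , 1)
    ((a , 1) ∷ (suc (suc a) , 1) ∷ (suc a , 0) ∷ []) bp
    (((λ ()) ∷ (λ ()) ∷ []) ∷ ((λ ()) ∷ []) ∷ [] ∷ [])
    ( (_ , west , ℕₚ.<⇒≤ a< , s≤s z≤n , inj₁ ℕₚ.≤-refl)
    ∷ (_ , east , a< , s≤s z≤n , inj₁ ℕₚ.≤-refl)
    ∷ (_ , south , ℕₚ.m≤n⇒m≤1+n a< , z≤n , inj₁ z≤n) ∷ [])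
    λ { (_ , west , _) → here refl ; (_ , east , _) → there (here refl)
      ; (_ , south , _) → there (there (here refl))
      ; (_ , north , v) → contradiction v ¬v }

  degree-top-left : ¬ Ver 0 1 → Black (0 , 1) → HasDegree (0 , 1) 2
  degree-top-left ¬v bp = gram-degree (0 , 1)
    ((1 , 1) ∷ (0 , 0) ∷ []) bp (((λ ()) ∷ []) ∷ [] ∷ [])
    ( (_ , east , z≤n , s≤s z≤n , inj₁ ℕₚ.≤-refl)
    ∷ (_ , south , z≤n , z≤n , inj₁ z≤n) ∷ [])
    λ { (_ , east , _) → here refl ; (_ , south , _) → there (here refl)
      ; (_ , north , v) → contradiction v ¬v }

  -- The vertical edge at height 1 forces `suc a` to be `r′`, so this is the inner turn.
  degree-inner : ∀ {a} → suc a ≤ r′ → Ver (suc a) 1 → Black (suc a , 1) → HasDegree (suc a , 1) 4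
  degree-inner {a} a< v bp = gram-degree (suc a , 1)
    ((a , 1) ∷ (suc (suc a) , 1) ∷ (suc a , 0) ∷ (suc a , 2) ∷ []) bp
    (((λ ()) ∷ (λ ()) ∷ (λ ()) ∷ []) ∷ ((λ ()) ∷ (λ ()) ∷ []) ∷ ((λ ()) ∷ []) ∷ [] ∷ [])
    ( (_ , west , ℕₚ.<⇒≤ a< , s≤s z≤n , inj₁ ℕₚ.≤-refl)
    ∷ (_ , east , a< , s≤s z≤n , inj₁ ℕₚ.≤-refl)
    ∷ (_ , south , ℕₚ.m≤n⇒m≤1+n a< , z≤n , inj₁ z≤n)
    ∷ (_ , north , v) ∷ [])
    λ { (_ , west , _) → here refl ; (_ , east , _) → there (here refl)
      ; (_ , south , _) → there (there (here refl))
      ; (_ , north , _) → there (there (there (here refl))) }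

  -- The inner turn for `r = 1`: it lies on the left side and lacks a western neighbour.
  degree-inner-left : Ver 0 1 → Black (0 , 1) → HasDegree (0 , 1) 3
  degree-inner-left v bp = gram-degree (0 , 1)
    ((1 , 1) ∷ (0 , 0) ∷ (0 , 2) ∷ []) bp
    (((λ ()) ∷ (λ ()) ∷ []) ∷ ((λ ()) ∷ []) ∷ [] ∷ [])
    ( (_ , east , z≤n , s≤s z≤n , inj₁ ℕₚ.≤-refl)
    ∷ (_ , south , z≤n , z≤n , inj₁ z≤n)
    ∷ (_ , north , v) ∷ [])
    λ { (_ , east , _) → here refl ; (_ , south , _) → there (here refl)
      ; (_ , north , _) → there (there (here refl)) }

  private
    ¬hor-west : ∀ {a b} → suc a ≡ r′ → 1 ≤ b → ¬ Hor a (suc b)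
    ¬hor-west a≡ 1≤b (_ , _ , inj₁ (s≤s b≤0)) = contradiction (ℕₚ.≤-trans 1≤b b≤0) λ ()
    ¬hor-west a≡ 1≤b (_ , _ , inj₂ r′≤a)      =
      contradiction (ℕₚ.≤-trans (ℕₚ.≤-reflexive a≡) r′≤a) ℕₚ.1+n≰n

  degree-column : ∀ {a b} → a ≡ r′ → 1 ≤ b → suc b ≤ s′ → Black (a , suc b) →
    HasDegree (a , suc b) 3
  degree-column {a} {b} a≡ 1≤b b< bp = gram-degree (a , suc b)
    ((suc a , suc b) ∷ (a , b) ∷ (a , suc (suc b)) ∷ []) bp
    (((λ ()) ∷ (λ ()) ∷ []) ∷ ((λ ()) ∷ []) ∷ [] ∷ [])
    ( (_ , east , ℕₚ.≤-reflexive a≡ , ℕₚ.m≤n⇒m≤1+n b< , inj₂ (ℕₚ.≤-reflexive (sym a≡)))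
    ∷ (_ , south , ℕₚ.m≤n⇒m≤1+n (ℕₚ.≤-reflexive a≡) , ℕₚ.<⇒≤ b< , inj₂ (ℕₚ.≤-reflexive (sym a≡)))
    ∷ (_ , north , ℕₚ.m≤n⇒m≤1+n (ℕₚ.≤-reflexive a≡) , b< , inj₂ (ℕₚ.≤-reflexive (sym a≡))) ∷ [])
    λ { (_ , east , _) → here refl ; (_ , south , _) → there (here refl)
      ; (_ , north , _) → there (there (here refl))
      ; (_ , west , h) → contradiction h (¬hor-west a≡ 1≤b) }

  degree-column-end : ∀ {a b} → a ≡ r′ → 1 ≤ b → b ≡ s′ → Black (a , suc b) →
    HasDegree (a , suc b) 2
  degree-column-end {a} {b} a≡ 1≤b b≡ bp = gram-degree (a , suc b)
    ((suc a , suc b) ∷ (a , b) ∷ []) bp (((λ ()) ∷ []) ∷ [] ∷ [])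
    ( (_ , east , ℕₚ.≤-reflexive a≡ , ℕₚ.≤-reflexive (cong suc b≡) , inj₂ (ℕₚ.≤-reflexive (sym a≡)))
    ∷ (_ , south , ℕₚ.m≤n⇒m≤1+n (ℕₚ.≤-reflexive a≡) , ℕₚ.≤-reflexive b≡
        , inj₂ (ℕₚ.≤-reflexive (sym a≡))) ∷ [])
    λ { (_ , east , _) → here refl ; (_ , south , _) → there (here refl)
      ; (_ , north , _ , b< , _) → contradiction (ℕₚ.≤-trans b< (ℕₚ.≤-reflexive (sym b≡))) ℕₚ.1+n≰n
      ; (_ , west , h) → contradiction h (¬hor-west a≡ 1≤b) }

-- The characteristic polynomial with rows and columns labelled by vertices

map-proj₂-enumerate : ∀ {A : Set} k (xs : List A) → map proj₂ (enumerate k xs) ≡ xs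
map-proj₂-enumerate k []       = refl
map-proj₂-enumerate k (x ∷ xs) = cong (x ∷_) (map-proj₂-enumerate (suc k) xs)

enumerate-map : ∀ {A B : Set} (f : A → B) k xs →
  enumerate k (map f xs) ≡ map (map₂ f) (enumerate k xs)
enumerate-map f k []       = refl
enumerate-map f k (x ∷ xs) = cong (_ ∷_) (enumerate-map f (suc k) xs)

enumerate-≤ : ∀ {A : Set} k (xs : List A) {j y} → (j , y) ∈ enumerate k xs → k ≤ j
enumerate-≤ k (x ∷ xs) (here refl) = ℕₚ.≤-refl
enumerate-≤ k (x ∷ xs) (there j∈)  = ℕₚ.<⇒≤ (enumerate-≤ (suc k) xs j∈)

enumerate-∈ : ∀ {A : Set} k (xs : List A) {j y} → (j , y) ∈ enumerate k xs → y ∈ xs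
enumerate-∈ k (x ∷ xs) (here refl) = here refl
enumerate-∈ k (x ∷ xs) (there j∈)  = there (enumerate-∈ (suc k) xs j∈)

enumerate-index : ∀ {A : Set} k {xs : List A} → Unique xs → ∀ {i x j y} →
  (i , x) ∈ enumerate k xs → (j , y) ∈ enumerate k xs → (i ≡ j × x ≡ y) ⊎ (i ≢ j × x ≢ y)
enumerate-index k (z≢ ∷ u) (here refl) (here refl) = inj₁ (refl , refl)
enumerate-index k {_ ∷ xs} (z≢ ∷ u) (here refl) (there j∈) =
  inj₂ (ℕₚ.<⇒≢ (enumerate-≤ (suc k) xs j∈) , All.lookup z≢ (enumerate-∈ (suc k) xs j∈))
enumerate-index k {_ ∷ xs} (z≢ ∷ u) (there i∈) (here refl) =
  inj₂ (ℕₚ.>⇒≢ (enumerate-≤ (suc k) xs i∈) , All.lookup z≢ (enumerate-∈ (suc k) xs i∈) ∘ sym)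
enumerate-index k (z≢ ∷ u) (there i∈) (there j∈) = enumerate-index (suc k) u i∈ j∈

==ℕ-≢ : ∀ {m n} → m ≢ n → (m ==ℕ n) ≡ false
==ℕ-≢ {m} {n} m≢n with m ==ℕ n in eq
... | true  = contradiction (==ℕ⇒≡ (≡true⇒T eq)) m≢n
... | false = refl

==Pt-≢ : ∀ {p q} → p ≢ q → (p ==Pt q) ≡ false
==Pt-≢ {p} {q} p≢q with p ==Pt q in eq
... | true  = contradiction (==Pt⇒≡ (≡true⇒T eq)) p≢q
... | false = refl

charEntry : (Pt → Pt → ℤ) → Pt → Pt → Poly
charEntry g p q = (if p ==Pt q then X else []) -P constP (g p q)

map-enumerate : ∀ {A B : Set} (F : ℕ × A → B) (G : A → B) xs →
  (∀ {i x} → (i , x) ∈ enumerate 0 xs → F (i , x) ≡ G x) → map F (enumerate 0 xs) ≡ map G xs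
map-enumerate F G xs eq = trans (Lₚ.map-cong-local (All.tabulate λ {(i , x)} i∈ → eq i∈))
  (trans (Lₚ.map-∘ (enumerate 0 xs)) (cong (map G) (map-proj₂-enumerate 0 xs)))

-- `charPoly` places the variable where indices agree, `charEntry` where vertices agree. In a list
-- without duplicates the two tests coincide.
charPoly≡det : ∀ (g : Pt → Pt → ℤ) {xs} → Unique xs →
  charPoly (map (λ p → map (g p) xs) xs) ≡ det (Laplace.submatrix (charEntry g) xs xs)
charPoly≡det g {xs} u = cong det (begin
  map _ (indexed (map (λ p → map (g p) xs) xs))
    ≡⟨ cong (map _) (trans (indexed≡enumerate (map (λ p → map (g p) xs) xs))
         (enumerate-map (λ p → map (g p) xs) 0 xs)) ⟩
  map _ (map (map₂ (λ p → map (g p) xs)) (enumerate 0 xs))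
    ≡⟨ Lₚ.map-∘ (enumerate 0 xs) ⟨
  map _ (enumerate 0 xs)
    ≡⟨ map-enumerate _ (λ p → map (charEntry g p) xs) xs (λ {i} {p} i∈ → begin
         map _ (indexed (map (g p) xs))
           ≡⟨ cong (map _) (trans (indexed≡enumerate (map (g p) xs)) (enumerate-map (g p) 0 xs)) ⟩
         map _ (map (map₂ (g p)) (enumerate 0 xs))
           ≡⟨ Lₚ.map-∘ (enumerate 0 xs) ⟨
         map _ (enumerate 0 xs)
           ≡⟨ map-enumerate _ (charEntry g p) xs (λ {j} {q} j∈ →
                cong (λ b → (if b then X else []) -P constP (g p q)) (index≡ i∈ j∈)) ⟩
         map (charEntry g p) xs ∎) ⟩
  map (λ p → map (charEntry g p) xs) xs ∎)
  where
  open ≡-Reasoning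
  index≡ : ∀ {i p j q} → (i , p) ∈ enumerate 0 xs → (j , q) ∈ enumerate 0 xs →
    (i ==ℕ j) ≡ (p ==Pt q)
  index≡ {i} {p} i∈ j∈ with enumerate-index 0 u i∈ j∈
  ... | inj₁ (refl , refl) = trans (T⇒≡true (==ℕ-refl i)) (sym (T⇒≡true (==Pt-refl p)))
  ... | inj₂ (i≢j , p≢q)   = trans (==ℕ-≢ i≢j) (sym (==Pt-≢ p≢q))

charPoly-minor : ∀ (g : Pt → Pt → ℤ) {xs} → Unique xs →
  charPoly (map (λ p → map (g p) xs) xs) ≋ Laplace.minor (charEntry g) xs xs
charPoly-minor g {xs} u = ≋-trans (≡⇒≋ (trans (charPoly≡det g u)
    (cong (λ n → detFuel n (Laplace.submatrix (charEntry g) xs xs)) (Lₚ.length-map _ xs))))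
  (Laplace.detFuel-minor (charEntry g) xs xs)

charEntry-diagonal : ∀ g p d → g p p ≡ + d → charEntry g p p ≡ shifted d
charEntry-diagonal g p d eq rewrite T⇒≡true (==Pt-refl p) | eq = refl

charEntry-off : ∀ g {p q} → p ≢ q → charEntry g p q ≡ (ℤ.- g p q) ∷ []
charEntry-off g p≢q rewrite ==Pt-≢ p≢q = refl

charEntry-zero : ∀ g p q → p ≢ q → g p q ≡ + 0 → charEntry g p q ≋ []
charEntry-zero g p q p≢q eq =
  ≋-trans (≡⇒≋ (trans (charEntry-off g p≢q) (cong (λ a → (ℤ.- a) ∷ []) eq))) shift-[]

charEntry-product : ∀ g p q → p ≢ q → g p q ℤ.* g q p ≡ + 1 →
  (charEntry g p q *P charEntry g q p) ≋ 1P
charEntry-product g p q p≢q eq = ≡⇒≋ (trans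
  (cong₂ _*P_ (charEntry-off g p≢q) (charEntry-off g (p≢q ∘ sym)))
  (cong (_∷ []) (trans (ℤₚ.+-identityʳ _)
    (trans (neg-*-neg (g p q) (g q p)) eq))))
  where
  neg-*-neg : ∀ i j → ℤ.- i ℤ.* ℤ.- j ≡ i ℤ.* j
  neg-*-neg i j = trans (sym (ℤₚ.neg-distribˡ-* i (ℤ.- j)))
    (trans (cong ℤ.-_ (sym (ℤₚ.neg-distribʳ-* i j))) (ℤₚ.neg-involutive (i ℤ.* j)))

-- Paths of black vertices and the splitting of the determinant

-- As the key grows strictly along a path, non-consecutive vertices are never one step apart.
key : Pt → ℕ
key (a , b) = a + b

step-key : ∀ {p q} → Step p q → key q ≡ 2 + key p
step-key right        = refl
step-key (up {a} {b}) = trans (ℕₚ.+-suc a (suc b)) (cong suc (ℕₚ.+-suc a b))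

path-key : ∀ {p ps} → Linked Step (p ∷ ps) → All (λ z → 2 + key p ≤ key z) ps
path-key [-]       = []
path-key (st ∷ path) = ℕₚ.≤-reflexive (sym (step-key st)) ∷
  All.map (ℕₚ.≤-trans (ℕₚ.≤-trans (ℕₚ.≤-reflexive (sym (step-key st))) (ℕₚ.m≤n+m _ 2)))
    (path-key path)

path-unique : ∀ {ps} → Linked Step ps → Unique ps
path-unique []          = []
path-unique [-]         = [] ∷ []
path-unique (st ∷ path) =
  All.map (λ { 2+p≤z refl → ℕₚ.<⇒≱ (ℕₚ.n<1+n _) (ℕₚ.≤-trans (ℕₚ.n≤1+n _) 2+p≤z) })
    (path-key (st ∷ path)) ∷ path-unique path

-- Black vertices with even second coordinate form the outer path, the others the inner one.
isOuter isInner : Pt → Bool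
isOuter (a , b) = (b % 2) ==ℕ 0
isInner p       = not (isOuter p)

module Components (r′ s′ : ℕ) (w : Weighting) (kast : IsKasteleyn (suc r′) (suc s′) w) where

  open Grid r′ s′
  open Gram r′ s′ w kast

  cell : Pt → Pt → Poly
  cell = charEntry gram

  open Laplace cell using (minor)
  open Tridiagonal cell

  Good : Pt → Set
  Good p = Black p × IsVertex p

  black-good : All Good (blackL r s)
  black-good = All.tabulate λ {p} p∈ →
    let p∈vertices , black = ∈-filter⁻ (T? ∘ isBlack r) {xs = verticesL r s} p∈
    in T⇒≡true black , ∈⇒vertex p∈vertices

  black-! : Unique (blackL r s)
  black-! = Uniqueₚ.filter⁺ (T? ∘ isBlack r)
    (Pt=.deduplicateᵇ-! (concatMap tileCorners (tilesL r s)))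

  chi-minor : chiL r s w ≋ minor (blackL r s) (blackL r s)
  chi-minor = ≋-trans (≡⇒≋ (cong charPoly matBBt≡)) (charPoly-minor gram black-!)
    where
    matBBt≡ : matBBt r s w ≡ map (λ p → map (gram p) (blackL r s)) (blackL r s)
    matBBt≡ = trans (sym (Lₚ.map-∘ (blackL r s)))
      (Lₚ.map-cong (λ p → sym (Lₚ.map-∘ (blackL r s))) (blackL r s))

  path-chain : ∀ {ps} → All Good ps → Linked Step ps → Chain ps
  path-chain []  []  = none
  path-chain (_ ∷ []) [-] = one _
  path-chain {p ∷ q ∷ ps} ((bp , vp) ∷ (bq , vq) ∷ good) (st ∷ path) = link
    (charEntry-product gram p q p≢q (gram-step st bp vp vq))
    (All.zipWith far (good , path-key path))
    (path-chain ((bq , vq) ∷ good) path)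
    where
    p≢q : p ≢ q
    p≢q = All.head (AllPairs.head (path-unique (st ∷ path)))
    far : ∀ {z} → Good z × 2 + key q ≤ key z → cell p z ≋ [] × cell z p ≋ []
    far {z} ((bz , _) , q≤z) =
      charEntry-zero gram p z p≢z (gram-zero {p} {z} bp bz p≢z ¬pz ¬zp)
      , charEntry-zero gram z p (p≢z ∘ sym) (gram-zero {z} {p} bz bp (p≢z ∘ sym) ¬zp ¬pz)
      where
      -- `z` lies beyond `q`, which itself is one step after `p`, and every step adds exactly 2 to
      -- the key.
      4+p≤z : 4 + key p ≤ key z
      4+p≤z = ℕₚ.≤-trans (ℕₚ.≤-reflexive (cong (ℕ._+_ 2) (sym (step-key st)))) q≤z
      p≢z : p ≢ z
      p≢z refl = ℕₚ.m+n≮n 3 (key p) 4+p≤z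
      ¬pz : ¬ Step p z
      ¬pz pz = ℕₚ.m+n≮n 1 (key p) (ℕₚ.≤-pred (ℕₚ.≤-pred (ℕₚ.≤-trans 4+p≤z (ℕₚ.≤-reflexive (step-key pz)))))
      ¬zp : ¬ Step z p
      ¬zp zp = ℕₚ.m+n≮n 5 (key z)
        (ℕₚ.≤-trans (ℕₚ.≤-reflexive (cong (ℕ._+_ 4) (sym (step-key zp)))) 4+p≤z)

  path-minor : ∀ {ps ds} → All Good ps → Linked Step ps → Pointwise HasDegree ps ds →
    minor ps ps ≋ K ds
  path-minor good path degrees =
    ≋-trans (minor-chain (path-chain good path)) (≡⇒≋ (cong continuant (diagonal degrees)))
    where
    diagonal : ∀ {ps ds} → Pointwise HasDegree ps ds → map (λ p → cell p p) ps ≡ map shifted ds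
    diagonal []                  = refl
    diagonal (_∷_ {p} {d} eq eqs) = cong₂ _∷_ (charEntry-diagonal gram p d eq) (diagonal eqs)

  step-outer : ∀ {p q} → Step p q → isOuter p ≡ isOuter q
  step-outer right = refl
  step-outer up    = refl

  chi-splits : chiL r s w ≋
    (minor (filterᵇ isOuter (blackL r s)) (filterᵇ isOuter (blackL r s))
      *P minor (filterᵇ isInner (blackL r s)) (filterᵇ isInner (blackL r s)))
  chi-splits = ≋-trans chi-minor
    (BlockSplitting.minor-blocks cell isOuter Good
      -- A step changes the second coordinate by 0 or 2, so vertices of different classes are
      -- neither equal nor a step apart.
      (λ {p} {q} (bp , _) (bq , _) p≁q → charEntry-zero gram p q (λ { refl → p≁q refl })
        (gram-zero {p} {q} bp bq (λ { refl → p≁q refl })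
          (λ st → p≁q (step-outer {p} {q} st)) (λ st → p≁q (sym (step-outer {q} {p} st)))))
      (blackL r s) black-good)

-- Reading the two paths off the list of tiles

-- Every tile has exactly one black corner in each class, and only neighbouring tiles share it,
-- so deduplication merely collapses runs of equal elements.
data Stutter {A : Set} : List A → List A → Set where
  []    : Stutter [] []
  new   : ∀ {x xs ys} → Stutter xs ys → Stutter (x ∷ xs) (x ∷ ys)
  again : ∀ {x xs ys} → Stutter (x ∷ xs) ys → Stutter (x ∷ x ∷ xs) ys

filter-comm : ∀ {A : Set} {P Q : A → Set} (P? : Decidable P) (Q? : Decidable Q) xs →
  filter P? (filter Q? xs) ≡ filter Q? (filter P? xs)
filter-comm P? Q? []       = refl
filter-comm P? Q? (x ∷ xs) with does (P? x) in p | does (Q? x) in q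
... | true  | true  rewrite p | q = cong (x ∷_) (filter-comm P? Q? xs)
... | true  | false rewrite q     = filter-comm P? Q? xs
... | false | true  rewrite p     = filter-comm P? Q? xs
... | false | false               = filter-comm P? Q? xs

filterᵇ-concatMap : ∀ {A B : Set} (P : B → Bool) (f : A → List B) xs →
  filterᵇ P (concatMap f xs) ≡ concatMap (filterᵇ P ∘ f) xs
filterᵇ-concatMap P f []       = refl
filterᵇ-concatMap P f (x ∷ xs) =
  trans (Lₚ.filter-++ (T? ∘ P) (f x) (concatMap f xs))
    (cong (filterᵇ P (f x) ++_) (filterᵇ-concatMap P f xs))

deduplicate-stutter : ∀ {xs ys} → Stutter xs ys → Unique ys → deduplicateᵇ _==Pt_ xs ≡ ys
deduplicate-stutter []                  u        = refl
deduplicate-stutter (new {x} {xs} {ys} st) (x≢ ∷ u) = cong (x ∷_) (trans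
  (cong (filter (¬? ∘ T? ∘ (x ==Pt_))) (deduplicate-stutter st u))
  (Lₚ.filter-all (¬? ∘ T? ∘ (x ==Pt_)) (All.map (λ x≢y t → x≢y (==Pt⇒≡ t)) x≢)))
deduplicate-stutter (again {x} {xs} st) u = trans
  (cong (x ∷_) (trans (Lₚ.filter-reject (¬? ∘ T? ∘ (x ==Pt_)) (λ ¬t → ¬t (==Pt-refl x)))
    (Lₚ.filter-idem (¬? ∘ T? ∘ (x ==Pt_)) (deduplicateᵇ _==Pt_ xs))))
  (deduplicate-stutter st u)

-- This allows colour and class to be selected tile by tile, before duplicates are removed.
filterᵇ-deduplicate : ∀ (P : Pt → Bool) xs →
  filterᵇ P (deduplicateᵇ _==Pt_ xs) ≡ deduplicateᵇ _==Pt_ (filterᵇ P xs)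
filterᵇ-deduplicate P []       = refl
filterᵇ-deduplicate P (x ∷ xs) with P x in px
... | true  = cong (x ∷_) (trans (filter-comm (T? ∘ P) (¬? ∘ T? ∘ (x ==Pt_)) (deduplicateᵇ _==Pt_ xs))
  (cong (filter (¬? ∘ T? ∘ (x ==Pt_))) (filterᵇ-deduplicate P xs)))
... | false = trans (filter-comm (T? ∘ P) (¬? ∘ T? ∘ (x ==Pt_)) (deduplicateᵇ _==Pt_ xs))
  (trans (Lₚ.filter-all (¬? ∘ T? ∘ (x ==Pt_)) (All.map x≁ (Allₚ.all-filter (T? ∘ P) (deduplicateᵇ _==Pt_ xs))))
    (filterᵇ-deduplicate P xs))
  where
  x≁ : ∀ {y} → T (P y) → ¬ T (x ==Pt y)
  x≁ py t with ==Pt⇒≡ {x} t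
  ... | refl rewrite px = py

-- Unlike `2 * n` this unfolds into two successors at once, so that lists of tiles reduce in pairs,
-- the period of the colouring.
double : ℕ → ℕ
double zero    = zero
double (suc n) = suc (suc (double n))

double≡2* : ∀ n → 2 ℕ.* n ≡ double n
double≡2* zero    = refl
double≡2* (suc n) = cong suc (trans (ℕₚ.+-suc n (n + 0)) (cong suc (double≡2* n)))

⌊double/2⌋ : ∀ n → ⌊ double n /2⌋ ≡ n
⌊double/2⌋ zero    = refl
⌊double/2⌋ (suc n) = cong suc (⌊double/2⌋ n)

⌈double/2⌉ : ∀ n → ⌈ double n /2⌉ ≡ n
⌈double/2⌉ zero    = refl
⌈double/2⌉ (suc n) = cong suc (⌈double/2⌉ n)

rowPath colPath : ℕ → ℕ → ℕ → List Pt
rowPath a b zero    = []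
rowPath a b (suc k) = (a , b) ∷ rowPath (suc (suc a)) b k
colPath a b zero    = []
colPath a b (suc k) = (a , b) ∷ colPath a (suc (suc b)) k

colPath-linked : ∀ a b k → Linked Step (colPath a b k)
colPath-linked a b zero          = []
colPath-linked a b (suc zero)    = [-]
colPath-linked a b (suc (suc k)) = up ∷ colPath-linked a (suc (suc b)) (suc k)

corner-linked : ∀ a b k → Linked Step ((a , b) ∷ colPath a (suc (suc b)) k)
corner-linked a b k = colPath-linked a b (suc k)

rowPath-linked : ∀ a b k {e ps} → double k + a ≡ e → Linked Step ((e , b) ∷ ps) →
  Linked Step (rowPath a b k ++ (e , b) ∷ ps)
rowPath-linked a b zero          refl path = path
rowPath-linked a b (suc zero)    refl path = right ∷ path
rowPath-linked a b (suc (suc k)) refl path =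
  right ∷ rowPath-linked (suc (suc a)) b (suc k)
    (cong (ℕ._+_ 2) (trans (ℕₚ.+-suc (double k) (suc a)) (cong suc (ℕₚ.+-suc (double k) a)))) path

module TilePaths (r′ s′ : ℕ) where

  open Grid r′ s′

  pick : (Pt → Bool) → Pt → List Pt
  pick c t = filterᵇ c (filterᵇ (isBlack r) (tileCorners t))

  class-deduplicate : ∀ c →
    filterᵇ c (blackL r s) ≡ deduplicateᵇ _==Pt_ (concatMap (pick c) (tilesL r s))
  class-deduplicate c = begin
    filterᵇ c (filterᵇ (isBlack r) (deduplicateᵇ _==Pt_ corners))
      ≡⟨ cong (filterᵇ c) (filterᵇ-deduplicate (isBlack r) corners) ⟩
    filterᵇ c (deduplicateᵇ _==Pt_ (filterᵇ (isBlack r) corners))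
      ≡⟨ filterᵇ-deduplicate c (filterᵇ (isBlack r) corners) ⟩
    deduplicateᵇ _==Pt_ (filterᵇ c (filterᵇ (isBlack r) corners))
      ≡⟨ cong (deduplicateᵇ _==Pt_ ∘ filterᵇ c) (filterᵇ-concatMap (isBlack r) tileCorners (tilesL r s)) ⟩
    deduplicateᵇ _==Pt_ (filterᵇ c (concatMap (filterᵇ (isBlack r) ∘ tileCorners) (tilesL r s)))
      ≡⟨ cong (deduplicateᵇ _==Pt_)
           (filterᵇ-concatMap c (filterᵇ (isBlack r) ∘ tileCorners) (tilesL r s)) ⟩
    deduplicateᵇ _==Pt_ (concatMap (pick c) (tilesL r s)) ∎
    where
    open ≡-Reasoning
    corners : List Pt
    corners = concatMap tileCorners (tilesL r s)

  White : Pt → Set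
  White p = isBlack r p ≡ false

  east-white : ∀ {a b} → Black (a , b) → White (suc a , b)
  east-white {a} {b} bp = trans (isBlack-east r a b) (cong notB bp)

  east-black : ∀ {a b} → White (a , b) → Black (suc a , b)
  east-black {a} {b} wp = trans (isBlack-east r a b) (cong notB wp)

  north-white : ∀ {a b} → Black (a , b) → White (a , suc b)
  north-white {a} {b} bp = trans (isBlack-north r a b) (cong notB bp)

  north-black : ∀ {a b} → White (a , b) → Black (a , suc b)
  north-black {a} {b} wp = trans (isBlack-north r a b) (cong notB wp)

  black-corners : ∀ {a b} → Black (a , b) →
    filterᵇ (isBlack r) (tileCorners (a , b)) ≡ (a , b) ∷ (suc a , suc b) ∷ []
  black-corners {a} {b} bp
    rewrite bp | east-white {a} {b} bp | north-white {a} {b} bp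
          | north-black {suc a} {b} (east-white {a} {b} bp) = refl

  white-corners : ∀ {a b} → White (a , b) →
    filterᵇ (isBlack r) (tileCorners (a , b)) ≡ (suc a , b) ∷ (a , suc b) ∷ []
  white-corners {a} {b} wp
    rewrite wp | east-black {a} {b} wp | north-black {a} {b} wp
          | north-white {suc a} {b} (east-black {a} {b} wp) = refl

  hrow vcol : ℕ → ℕ → List Pt
  hrow a zero    = []
  hrow a (suc n) = (a , 0) ∷ hrow (suc a) n
  vcol b zero    = []
  vcol b (suc n) = (r′ , b) ∷ vcol (suc b) n

  tilesL≡ : tilesL r s ≡ hrow 0 r ++ vcol 1 s′
  tilesL≡ = cong₂ _++_ (row≡ (λ i → (i , 0)) 0 r λ i → refl)
    (col≡ (λ j → (r′ , suc j)) 1 s′ λ j → refl)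
    where
    row≡ : ∀ f a n → (∀ i → f i ≡ (a + i , 0)) → applyUpTo f n ≡ hrow a n
    row≡ f a zero    eq = refl
    row≡ f a (suc n) eq = cong₂ _∷_ (trans (eq 0) (cong (_, 0) (ℕₚ.+-identityʳ a)))
      (row≡ (f ∘ suc) (suc a) n λ i → trans (eq (suc i)) (cong (_, 0) (ℕₚ.+-suc a i)))
    col≡ : ∀ f b n → (∀ j → f j ≡ (r′ , b + j)) → applyUpTo f n ≡ vcol b n
    col≡ f b zero    eq = refl
    col≡ f b (suc n) eq = cong₂ _∷_ (trans (eq 0) (cong (r′ ,_) (ℕₚ.+-identityʳ b)))
      (col≡ (f ∘ suc) (suc b) n λ i → trans (eq (suc i)) (cong (r′ ,_) (ℕₚ.+-suc b i)))

  outer-tile-black : ∀ {a} → Black (a , 0) → pick isOuter (a , 0) ≡ (a , 0) ∷ []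
  outer-tile-black {a} bp = cong (filterᵇ isOuter) (black-corners {a} {0} bp)

  outer-tile-white : ∀ {a} → White (a , 0) → pick isOuter (a , 0) ≡ (suc a , 0) ∷ []
  outer-tile-white {a} wp = cong (filterᵇ isOuter) (white-corners {a} {0} wp)

  inner-tile-black : ∀ {a} → Black (a , 0) → pick isInner (a , 0) ≡ (suc a , 1) ∷ []
  inner-tile-black {a} bp = cong (filterᵇ isInner) (black-corners {a} {0} bp)

  inner-tile-white : ∀ {a} → White (a , 0) → pick isInner (a , 0) ≡ (a , 1) ∷ []
  inner-tile-white {a} wp = cong (filterᵇ isInner) (white-corners {a} {0} wp)

  -- `isOuter` depends on the second coordinate only, so the 0 is a placeholder; in this form the
  -- hypothesis can be used for rewriting.
  Odd : ℕ → Set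
  Odd b = isOuter (0 , b) ≡ false

  odd⇒even : ∀ b → Odd b → isOuter (0 , suc b) ≡ true
  odd⇒even b odd = trans (==ℕ-flip b 0) (cong notB odd)

  odd-tile : ∀ {b} → Odd b → Black (r′ , b) →
    pick isOuter (r′ , b) ≡ (r , suc b) ∷ [] × pick isInner (r′ , b) ≡ (r′ , b) ∷ []
  odd-tile {b} odd bp rewrite black-corners {r′} {b} bp | odd | odd⇒even b odd = refl , refl

  even-tile : ∀ {b} → Odd b → Black (r′ , b) →
    pick isOuter (r′ , suc b) ≡ (r , suc b) ∷ []
    × pick isInner (r′ , suc b) ≡ (r′ , suc (suc b)) ∷ []
  even-tile {b} odd bp
    rewrite white-corners {r′} {suc b} (north-white {r′} {b} bp) | odd⇒even b odd | odd = refl , refl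

  black-up2 : ∀ {a b} → Black (a , b) → Black (a , suc (suc b))
  black-up2 {a} {b} bp = north-black {a} {suc b} (north-white {a} {b} bp)

  -- For odd `b` the tiles at heights `b` and `b + 1` share the outer vertex `(r , b + 1)`, so an
  -- unpaired last tile still brings a new vertex and half of `k` is rounded up.
  outer-column : ∀ b k → Odd b → Black (r′ , b) →
    Stutter (concatMap (pick isOuter) (vcol b k)) (colPath r (suc b) ⌈ k /2⌉)
  outer-column b zero          odd bp = []
  outer-column b (suc zero)    odd bp rewrite proj₁ (odd-tile {b} odd bp) = new []
  outer-column b (suc (suc k)) odd bp
    rewrite proj₁ (odd-tile {b} odd bp) | proj₁ (even-tile {b} odd bp) =
    again (new (outer-column (suc (suc b)) k odd (black-up2 {r′} {b} bp)))

  -- Here the tile at odd height repeats the vertex listed just before it, and only the next tile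
  -- brings a new one. This explains the vertex in front of both lists and the rounding down.
  inner-column : ∀ b k → Odd b → Black (r′ , b) →
    Stutter ((r′ , b) ∷ concatMap (pick isInner) (vcol b k))
      ((r′ , b) ∷ colPath r′ (suc (suc b)) ⌊ k /2⌋)
  inner-column b zero          odd bp = new []
  inner-column b (suc zero)    odd bp rewrite proj₂ (odd-tile {b} odd bp) = again (new [])
  inner-column b (suc (suc k)) odd bp
    rewrite proj₂ (odd-tile {b} odd bp) | proj₂ (even-tile {b} odd bp) =
    again (new (inner-column (suc (suc b)) k odd (black-up2 {r′} {b} bp)))

  private
    double-suc : ∀ k a {e} → double (suc k) + a ≡ e → double k + suc (suc a) ≡ e
    double-suc k a eq = trans (trans (ℕₚ.+-suc (double k) (suc a))
      (cong suc (ℕₚ.+-suc (double k) a))) eq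

  -- `(a , 0)` stands in front because the tile to the left has already listed it. The end `(e , 0)`
  -- stays open on the right so that the column can be attached at the corner.
  outer-row : ∀ a k {e zs ys} → Black (a , 0) → double k + a ≡ e →
    Stutter ((e , 0) ∷ zs) ((e , 0) ∷ ys) →
    Stutter ((a , 0) ∷ concatMap (pick isOuter) (hrow a (double k)) ++ zs)
      (rowPath a 0 k ++ (e , 0) ∷ ys)
  outer-row a zero    bp refl st = st
  outer-row a (suc k) bp eq   st
    rewrite outer-tile-black {a} bp | outer-tile-white {suc a} (east-white {a} {0} bp) =
    again (new (outer-row (suc (suc a)) k bp (double-suc k a eq) st))

  inner-row : ∀ a k {e zs ys} → Black (a , 0) → double k + suc a ≡ e →
    Stutter ((e , 1) ∷ zs) ((e , 1) ∷ ys) →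
    Stutter (concatMap (pick isInner) (hrow a (double (suc k))) ++ zs)
      (rowPath (suc a) 1 k ++ (e , 1) ∷ ys)
  inner-row a zero    bp refl st
    rewrite inner-tile-black {a} bp | inner-tile-white {suc a} (east-white {a} {0} bp) = again st
  inner-row a (suc k) bp eq   st
    rewrite inner-tile-black {a} bp | inner-tile-white {suc a} (east-white {a} {0} bp) =
    again (new (inner-row (suc (suc a)) k bp (double-suc k (suc a) eq) st))

  even-outer-row : ∀ m {e zs ys} → Black (0 , 0) → double m + 2 ≡ e →
    Stutter ((e , 0) ∷ zs) ((e , 0) ∷ ys) →
    Stutter (concatMap (pick isOuter) (hrow 0 (double (suc m))) ++ zs)
      ((0 , 0) ∷ rowPath 2 0 m ++ (e , 0) ∷ ys)
  even-outer-row m bp eq st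
    rewrite outer-tile-black {0} bp | outer-tile-white {1} (east-white {0} {0} bp) =
    new (outer-row 2 m bp eq st)

  odd-outer-row : ∀ m {e zs ys} → White (0 , 0) → double m + 1 ≡ e →
    Stutter ((e , 0) ∷ zs) ((e , 0) ∷ ys) →
    Stutter (concatMap (pick isOuter) (hrow 0 (suc (double m))) ++ zs)
      (rowPath 1 0 m ++ (e , 0) ∷ ys)
  odd-outer-row m wp eq st rewrite outer-tile-white {0} wp =
    outer-row 1 m (east-black {0} {0} wp) eq st

  odd-inner-row-one : ∀ {zs ys} → White (0 , 0) → Stutter ((0 , 1) ∷ zs) ((0 , 1) ∷ ys) →
    Stutter (concatMap (pick isInner) (hrow 0 1) ++ zs) ((0 , 1) ∷ ys)
  odd-inner-row-one wp st rewrite inner-tile-white {0} wp = st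

  odd-inner-row : ∀ k {e zs ys} → White (0 , 0) → double k + 2 ≡ e →
    Stutter ((e , 1) ∷ zs) ((e , 1) ∷ ys) →
    Stutter (concatMap (pick isInner) (hrow 0 (suc (double (suc k)))) ++ zs)
      ((0 , 1) ∷ rowPath 2 1 k ++ (e , 1) ∷ ys)
  odd-inner-row k wp eq st rewrite inner-tile-white {0} wp =
    new (inner-row 1 k (east-black {0} {0} wp) eq st)

-- Minors of the two paths for both parities of the row

black-origin : ∀ m → isBlack (double m) (0 , 0) ≡ true
black-origin zero    = refl
black-origin (suc m) = black-origin m

white-origin : ∀ m → isBlack (suc (double m)) (0 , 0) ≡ false
white-origin zero    = refl
white-origin (suc m) = white-origin m

module Assembly (r′ s′ : ℕ) (w : Weighting) (kast : IsKasteleyn (suc r′) (suc s′) w) where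

  open Grid r′ s′ public
  open Gram r′ s′ w kast public
  open Components r′ s′ w kast public
  open TilePaths r′ s′ public
  open Laplace cell public using (minor)

  private
    bound-head : ∀ k {a c} → double (suc k) + a ≤ suc (suc c) → a ≤ c
    bound-head k (s≤s (s≤s le)) = ℕₚ.m+n≤o⇒n≤o (double k) le

    bound-tail : ∀ k {a c} → double (suc k) + a ≤ c → double k + suc (suc a) ≤ c
    bound-tail k {a} le = ℕₚ.≤-trans (ℕₚ.≤-reflexive
      (trans (ℕₚ.+-suc (double k) (suc a)) (cong suc (ℕₚ.+-suc (double k) a)))) le

  bottom-degrees : ∀ a k → double k + suc a ≤ 2 + r′ → All Black (rowPath (suc a) 0 k) →
    Pointwise HasDegree (rowPath (suc a) 0 k) (replicate k 3)
  bottom-degrees a zero    le []           = []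
  bottom-degrees a (suc k) le (bp ∷ black) =
    degree-bottom (bound-head k le) bp
    ∷ bottom-degrees (suc (suc a)) k (bound-tail k le) black

  top-degrees : ∀ a k → double k + suc a ≤ 1 + r′ → All Black (rowPath (suc a) 1 k) →
    Pointwise HasDegree (rowPath (suc a) 1 k) (replicate k 3)
  top-degrees a zero    le []           = []
  top-degrees a (suc k) le (bp ∷ black) =
    degree-top (ℕₚ.<⇒≤ a<) (λ { (_ , _ , inj₁ ()) ; (_ , _ , inj₂ r′≤a) → ℕₚ.<⇒≱ a< r′≤a }) bp
    ∷ top-degrees (suc (suc a)) k (bound-tail k le) black
    where
    a< : suc a < r′
    a< = ℕₚ.≤-trans (s≤s (ℕₚ.m≤n+m (suc a) (double k))) (ℕₚ.≤-pred le)

  -- Serves the vertical part of the outer path on the line `r` and of the inner path on the line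
  -- `r′`. In `degrees` the path stops below the top; in `degrees-end` its last vertex has height
  -- `s`, hence degree 2.
  module Column (a : ℕ)
    (interior : ∀ {b} → 1 ≤ b → suc b ≤ s′ → Black (a , suc b) → HasDegree (a , suc b) 3)
    (end : ∀ {b} → 1 ≤ b → b ≡ s′ → Black (a , suc b) → HasDegree (a , suc b) 2) where

    degrees : ∀ b n → 1 ≤ b → double n + suc b ≤ 2 + s′ → All Black (colPath a (suc b) n) →
      Pointwise HasDegree (colPath a (suc b) n) (replicate n 3)
    degrees b zero    1≤b le []           = []
    degrees b (suc n) 1≤b le (bp ∷ black) =
      interior 1≤b (bound-head n le) bp
      ∷ degrees (suc (suc b)) n (s≤s z≤n) (bound-tail n le) black

    degrees-end : ∀ b n → 1 ≤ b → double n + suc b ≡ s → All Black (colPath a (suc b) (suc n)) →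
      Pointwise HasDegree (colPath a (suc b) (suc n)) (replicate n 3 ∷ʳ 2)
    degrees-end b zero    1≤b eq (bp ∷ [])    = end 1≤b (ℕₚ.suc-injective eq) bp ∷ []
    degrees-end b (suc n) 1≤b eq (bp ∷ black) =
      interior 1≤b (bound-head n (ℕₚ.m≤n⇒m≤1+n (ℕₚ.≤-reflexive eq))) bp
      ∷ degrees-end (suc (suc b)) n (s≤s z≤n)
          (trans (trans (ℕₚ.+-suc (double n) (suc (suc b))) (cong suc (ℕₚ.+-suc (double n) (suc b)))) eq)
          black

  module Right = Column r (λ _ → degree-right) (λ _ → degree-right-end)
  module Left  = Column r′ (degree-column refl) (degree-column-end refl)

  class-minor : ∀ c {path ds} → Stutter (concatMap (pick c) (hrow 0 r ++ vcol 1 s′)) path →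
    Linked Step path → (All Black path → Pointwise HasDegree path ds) →
    minor (filterᵇ c (blackL r s)) (filterᵇ c (blackL r s)) ≋ K ds
  class-minor c {path} {ds} st linked degrees =
    subst (λ ps → minor ps ps ≋ K ds) (sym class≡) (path-minor good linked (degrees (All.map proj₁ good)))
    where
    class≡ : filterᵇ c (blackL r s) ≡ path
    class≡ = trans (class-deduplicate c)
      (trans (cong (deduplicateᵇ _==Pt_ ∘ concatMap (pick c)) tilesL≡)
        (deduplicate-stutter st (path-unique linked)))
    -- Blackness and membership in the graph need no computation along the path, since the path is a
    -- part of `blackL`.
    good : All Good path
    good = subst (All Good) class≡ (Allₚ.filter⁺ (T? ∘ c) black-good)

  black-inner-corner : Black (r′ , 1)
  black-inner-corner =
    trans (cong (λ k → (k % 2) ==ℕ (r % 2)) (ℕₚ.+-comm r′ 1)) (T⇒≡true (==ℕ-refl (r % 2)))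

  private
    split-degrees : ∀ ps c qs {dp d dq} →
      (All Black ps → Pointwise HasDegree ps dp) → (Black c → HasDegree c d) →
      (All Black qs → Pointwise HasDegree qs dq) →
      All Black (ps ++ c ∷ qs) → Pointwise HasDegree (ps ++ c ∷ qs) (dp ++ d ∷ dq)
    split-degrees ps c qs f g h black with Allₚ.++⁻ ps black
    ... | bps , bc ∷ bqs = Pointwise.++⁺ (f bps) (g bc ∷ h bqs)

  outerMinor innerMinor : Poly
  outerMinor = minor (filterᵇ isOuter (blackL r s)) (filterᵇ isOuter (blackL r s))
  innerMinor = minor (filterᵇ isInner (blackL r s)) (filterᵇ isInner (blackL r s))

  -- The left arm enters as a transformation of anything that begins at the corner, so that even and
  -- odd rows can share the treatment of the column.
  outer-minor : ∀ {left dl dr} k → k ≡ ⌈ s′ /2⌉ →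
    (∀ {zs ys} → Stutter ((r , 0) ∷ zs) ((r , 0) ∷ ys) →
      Stutter (concatMap (pick isOuter) (hrow 0 r) ++ zs) (left ++ (r , 0) ∷ ys)) →
    (∀ {ps} → Linked Step ((r , 0) ∷ ps) → Linked Step (left ++ (r , 0) ∷ ps)) →
    (All Black left → Pointwise HasDegree left dl) →
    (All Black (colPath r 2 k) → Pointwise HasDegree (colPath r 2 k) dr) →
    outerMinor ≋ K (dl ++ 2 ∷ dr)
  outer-minor {left} k refl row linked degl degr = class-minor isOuter
    (subst (λ zs → Stutter zs (left ++ (r , 0) ∷ colPath r 2 k)) (sym (Lₚ.concatMap-++ (pick isOuter) (hrow 0 r) (vcol 1 s′)))
      (row (new (outer-column 1 s′ refl black-inner-corner))))
    (linked (corner-linked r 0 k))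
    (split-degrees left (r , 0) (colPath r 2 k) degl degree-corner degr)

  inner-minor : ∀ {left dl d dr} k → k ≡ ⌊ s′ /2⌋ →
    (∀ {zs ys} → Stutter ((r′ , 1) ∷ zs) ((r′ , 1) ∷ ys) →
      Stutter (concatMap (pick isInner) (hrow 0 r) ++ zs) (left ++ (r′ , 1) ∷ ys)) →
    (∀ {ps} → Linked Step ((r′ , 1) ∷ ps) → Linked Step (left ++ (r′ , 1) ∷ ps)) →
    (All Black left → Pointwise HasDegree left dl) →
    (Black (r′ , 1) → HasDegree (r′ , 1) d) →
    (All Black (colPath r′ 3 k) → Pointwise HasDegree (colPath r′ 3 k) dr) →
    innerMinor ≋ K (dl ++ d ∷ dr)
  inner-minor {left} k refl row linked degl degc degr = class-minor isInner
    (subst (λ zs → Stutter zs (left ++ (r′ , 1) ∷ colPath r′ 3 k)) (sym (Lₚ.concatMap-++ (pick isInner) (hrow 0 r) (vcol 1 s′)))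
      (row (inner-column 1 s′ refl black-inner-corner)))
    (linked (corner-linked r′ 1 k))
    (split-degrees left (r′ , 1) (colPath r′ 3 k) degl degc degr)

  -- The splitting yields the outer factor first, whereas the closed formulas begin with the inner
  -- one.
  chi-product : ∀ {p q} →
    innerMinor ≋ p →
    outerMinor ≋ q →
    chiL r s w ≋ (p *P q)
  chi-product {p} {q} inner outer =
    ≋-trans chi-splits (≋-trans (*P-cong outer inner) (*P-comm q p))

-- For even `r` the origin is black and is the end of degree 2 of the outer path; the inner path
-- begins at `(1 , 1)`.
module EvenRow (m s′ : ℕ) (w : Weighting) (kast : IsKasteleyn (double (suc m)) (suc s′) w) where

  open Assembly (suc (double m)) s′ w kast public

  outer-even : ∀ {dr} k → k ≡ ⌈ s′ /2⌉ →
    (All Black (colPath r 2 k) → Pointwise HasDegree (colPath r 2 k) dr) →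
    outerMinor ≋ K (2 ∷ replicate m 3 ++ 2 ∷ dr)
  outer-even k k≡ = outer-minor {(0 , 0) ∷ rowPath 2 0 m} {2 ∷ replicate m 3} k k≡
    (even-outer-row m (black-origin (suc m)) (ℕₚ.+-comm (double m) 2))
    (rowPath-linked 0 0 (suc m) (ℕₚ.+-identityʳ (double (suc m))))
    λ { (bp ∷ black) → degree-origin bp ∷ bottom-degrees 1 m
          (ℕₚ.≤-trans (ℕₚ.≤-reflexive (ℕₚ.+-comm (double m) 2)) (ℕₚ.n≤1+n _)) black }

  inner-even : ∀ {d dr} k → k ≡ ⌊ s′ /2⌋ →
    (Black (suc (double m) , 1) → HasDegree (suc (double m) , 1) d) →
    (All Black (colPath (suc (double m)) 3 k) → Pointwise HasDegree (colPath (suc (double m)) 3 k) dr) →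
    innerMinor ≋ K (replicate m 3 ++ d ∷ dr)
  inner-even k k≡ = inner-minor {rowPath 1 1 m} {replicate m 3} k k≡
    (inner-row 0 m (black-origin (suc m)) (ℕₚ.+-comm (double m) 1))
    (rowPath-linked 1 1 m (ℕₚ.+-comm (double m) 1))
    (top-degrees 0 m (ℕₚ.≤-trans (ℕₚ.≤-reflexive (ℕₚ.+-comm (double m) 1)) (ℕₚ.n≤1+n _)))

-- For odd `r` the origin is white: the outer path begins at `(1 , 0)` and the inner one at
-- `(0 , 1)`. For `r = 1` the latter is already the inner turn, so the inner minors for `r = 1` and
-- for longer rows are computed separately.
module OddRow (m s′ : ℕ) (w : Weighting) (kast : IsKasteleyn (suc (double m)) (suc s′) w) where

  open Assembly (double m) s′ w kast public

  outer-odd : ∀ {dr} k → k ≡ ⌈ s′ /2⌉ →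
    (All Black (colPath r 2 k) → Pointwise HasDegree (colPath r 2 k) dr) →
    outerMinor ≋ K (replicate m 3 ++ 2 ∷ dr)
  outer-odd k k≡ = outer-minor {rowPath 1 0 m} {replicate m 3} k k≡
    (odd-outer-row m (white-origin m) (ℕₚ.+-comm (double m) 1))
    (rowPath-linked 1 0 m (ℕₚ.+-comm (double m) 1))
    (bottom-degrees 0 m (ℕₚ.≤-trans (ℕₚ.≤-reflexive (ℕₚ.+-comm (double m) 1)) (ℕₚ.n≤1+n _)))

module OneColumn (s′ : ℕ) (w : Weighting) (kast : IsKasteleyn 1 (suc s′) w) where

  open OddRow 0 s′ w kast public

  inner-one : ∀ {d dr} k → k ≡ ⌊ s′ /2⌋ →
    (Black (0 , 1) → HasDegree (0 , 1) d) →
    (All Black (colPath 0 3 k) → Pointwise HasDegree (colPath 0 3 k) dr) →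
    innerMinor ≋ K (d ∷ dr)
  inner-one k k≡ = inner-minor {[]} {[]} k k≡
    (odd-inner-row-one (white-origin 0)) id λ { [] → [] }

module LongOddRow (m s′ : ℕ) (w : Weighting)
  (kast : IsKasteleyn (suc (double (suc m))) (suc s′) w) where

  open OddRow (suc m) s′ w kast public

  inner-odd : ∀ {d dr} k → k ≡ ⌊ s′ /2⌋ →
    (Black (double (suc m) , 1) → HasDegree (double (suc m) , 1) d) →
    (All Black (colPath (double (suc m)) 3 k) → Pointwise HasDegree (colPath (double (suc m)) 3 k) dr) →
    innerMinor ≋ K (2 ∷ replicate m 3 ++ d ∷ dr)
  inner-odd k k≡ = inner-minor {(0 , 1) ∷ rowPath 2 1 m} {2 ∷ replicate m 3} k k≡
    (odd-inner-row m (white-origin (suc m)) (ℕₚ.+-comm (double m) 2))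
    (rowPath-linked 0 1 (suc m) (ℕₚ.+-identityʳ (double (suc m))))
    λ { (bp ∷ black) → degree-top-left (λ { (_ , _ , inj₁ ()) ; (_ , _ , inj₂ ()) }) bp
          ∷ top-degrees 1 m
              (ℕₚ.≤-trans (ℕₚ.≤-reflexive (ℕₚ.+-comm (double m) 2)) (ℕₚ.n≤1+n _)) black }

-- The three parity cases

chi-even-even : ∀ m n w → IsKasteleyn (double (suc m)) (double (suc n)) w →
  chiL (double (suc m)) (double (suc n)) w ≋
    ((Qp (m + suc n) -P Qp m *P Qp n)
      *P ((X -P constP (+ 1)) *P Qp (suc m + suc n) +P Pp (suc m) *P Pp (suc n)))
chi-even-even m n w kast = chi-product
  (≋-trans (inner-even n (sym (⌈double/2⌉ n))
      (degree-inner ℕₚ.≤-refl (ℕₚ.n≤1+n _ , s≤s z≤n , inj₂ ℕₚ.≤-refl))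
      -- For even `s` the top of the line `r` is black and that of the line `r′` is white, so only
      -- the outer path reaches the height `s`.
      (Left.degrees 2 n (s≤s z≤n) (ℕₚ.≤-reflexive (ℕₚ.+-comm (double n) 3))))
    (innerEE m n))
  (≋-trans (outer-even (suc n) (cong suc (sym (⌊double/2⌋ n)))
      (Right.degrees-end 1 n (s≤s z≤n) (ℕₚ.+-comm (double n) 2)))
    (outerEE m n))
  where open EvenRow m (suc (double n)) w kast

chi-even-odd : ∀ m n w → IsKasteleyn (double (suc m)) (suc (double n)) w →
  chiL (double (suc m)) (suc (double n)) w ≋
    ((Pp (suc m + n) -P Qp m *P Pp n) *P (Pp (suc m + suc n) +P Pp (suc m) *P Qp n))
chi-even-odd m n w kast = chi-product (inner n kast)
  (≋-trans (outer-even n (sym (⌈double/2⌉ n))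
      (Right.degrees 1 n (s≤s z≤n) (ℕₚ.≤-reflexive (ℕₚ.+-comm (double n) 2))))
    (outerEO m n))
  where
  open EvenRow m (double n) w kast
  -- The weighting hypothesis is generalised together with `n` because its type changes in the case
  -- distinction.
  inner : ∀ n (kast : IsKasteleyn (double (suc m)) (suc (double n)) w) →
    EvenRow.innerMinor m (double n) w kast ≋ (Pp (suc m + n) -P Qp m *P Pp n)
  inner zero kast = ≋-trans
    -- With a single row of tiles nothing lies above the inner turn, and its degree is that of any
    -- other vertex inside the top line.
    (E.inner-even 0 refl (E.degree-top ℕₚ.≤-refl λ { (_ , () , _) }) λ { [] → [] })
    (innerEO-zero m)
    where module E = EvenRow m 0 w kast
  inner (suc n) kast = ≋-trans
    (E.inner-even (suc n) (cong suc (sym (⌊double/2⌋ n)))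
      (E.degree-inner ℕₚ.≤-refl (ℕₚ.n≤1+n _ , s≤s z≤n , inj₂ ℕₚ.≤-refl))
      (E.Left.degrees-end 2 n (s≤s z≤n) (ℕₚ.+-comm (double n) 3)))
    (innerEO-suc m n)
    where module E = EvenRow m (double (suc n)) w kast

chi-odd-odd : ∀ m n w → IsKasteleyn (suc (double m)) (suc (double n)) w →
  chiL (suc (double m)) (suc (double n)) w ≋
    (((X -P constP (+ 1)) *P Qp (m + n) -P Pp m *P Pp n)
      *P (Qp (m + suc n) +P Qp m *P Qp n))
chi-odd-odd m n w kast = chi-product (inner m n kast)
  (≋-trans (outer-odd n (sym (⌈double/2⌉ n))
      (Right.degrees 1 n (s≤s z≤n) (ℕₚ.≤-reflexive (ℕₚ.+-comm (double n) 2))))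
    (outerOO m n))
  where
  open OddRow m (double n) w kast
  -- The inner turn loses one neighbour for each missing arm: its degree is 2 if both are missing, 3
  -- if one is, and 4 otherwise.
  inner : ∀ m n (kast : IsKasteleyn (suc (double m)) (suc (double n)) w) →
    OddRow.innerMinor m (double n) w kast ≋ ((X -P constP (+ 1)) *P Qp (m + n) -P Pp m *P Pp n)
  inner zero zero kast = ≋-trans
    (O.inner-one 0 refl (O.degree-top-left λ { (_ , () , _) }) λ { [] → [] })
    innerOO-zero-zero
    where module O = OneColumn 0 w kast
  inner zero (suc n) kast = ≋-trans
    (O.inner-one (suc n) (cong suc (sym (⌊double/2⌋ n)))
      (O.degree-inner-left (z≤n , s≤s z≤n , inj₂ z≤n))
      (O.Left.degrees-end 2 n (s≤s z≤n) (ℕₚ.+-comm (double n) 3)))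
    (innerOO-zero-suc n)
    where module O = OneColumn (double (suc n)) w kast
  inner (suc m) zero kast = ≋-trans
    (O.inner-odd 0 refl (O.degree-top ℕₚ.≤-refl λ { (_ , () , _) }) λ { [] → [] })
    (innerOO-suc-zero m)
    where module O = LongOddRow m 0 w kast
  inner (suc m) (suc n) kast = ≋-trans
    (O.inner-odd (suc n) (cong suc (sym (⌊double/2⌋ n)))
      (O.degree-inner ℕₚ.≤-refl (ℕₚ.n≤1+n _ , s≤s z≤n , inj₂ ℕₚ.≤-refl))
      (O.Left.degrees-end 2 n (s≤s z≤n) (ℕₚ.+-comm (double n) 3)))
    (innerOO-suc-suc m n)
    where module O = LongOddRow m (double (suc n)) w kast

chi-cong : ∀ {r r′ s s′ p q} → r ≡ r′ → s ≡ s′ → p ≡ q →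
  (∀ w → IsKasteleyn r′ s′ w → chiL r′ s′ w ≋ q) →
  ∀ w → IsKasteleyn r s w → chiL r s w ≈P p
chi-cong refl refl refl chi w kast = coeff≡ (chi w kast)

2*+1≡ : ∀ n → 2 ℕ.* n + 1 ≡ suc (double n)
2*+1≡ n = trans (ℕₚ.+-comm (2 ℕ.* n) 1) (cong suc (double≡2* n))

+1≡ : ∀ m n → m + n + 1 ≡ m + suc n
+1≡ m n = trans (ℕₚ.+-comm (m + n) 1) (sym (ℕₚ.+-suc m n))

theorem5p5 : ((m n : ℕ) → 1 ≤ m → 1 ≤ n → (w : Weighting) → IsKasteleyn (2 * m) (2 * n) w →
    chiL (2 * m) (2 * n) w ≈P
    ((Qp (m + n ∸ 1) -P Qp (m ∸ 1) *P Qp (n ∸ 1))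
    *P ((X -P constP (+ 1)) *P Qp (m + n) +P Pp m *P Pp n)))
    × ((m n : ℕ) → (w : Weighting) → IsKasteleyn (2 * m + 1) (2 * n + 1) w →
    chiL (2 * m + 1) (2 * n + 1) w ≈P
    (((X -P constP (+ 1)) *P Qp (m + n) -P Pp m *P Pp n)
    *P (Qp (m + n + 1) +P Qp m *P Qp n)))
    × ((m n : ℕ) → 1 ≤ m → (w : Weighting) → IsKasteleyn (2 * m) (2 * n + 1) w →
    chiL (2 * m) (2 * n + 1) w ≈P
    ((Pp (m + n) -P Qp (m ∸ 1) *P Pp n)
    *P (Pp (m + n + 1) +P Pp m *P Qp n)))
theorem5p5 =
    -- `suc m + suc n ∸ 1` reduces to `m + suc n`, so the two polynomials agree by `refl`.
    (λ { (suc m) (suc n) _ _ → chi-cong (double≡2* (suc m)) (double≡2* (suc n)) refl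
           (chi-even-even m n) })
  , (λ m n → chi-cong (2*+1≡ m) (2*+1≡ n)
       (cong (λ k → ((X -P constP (+ 1)) *P Qp (m + n) -P Pp m *P Pp n) *P (Qp k +P Qp m *P Qp n))
         (+1≡ m n))
       (chi-odd-odd m n))
  , (λ { (suc m) n _ → chi-cong (double≡2* (suc m)) (2*+1≡ n)
           (cong (λ k → (Pp (suc m + n) -P Qp m *P Pp n) *P (Pp k +P Pp (suc m) *P Qp n))
             (+1≡ (suc m) n))
           (chi-even-odd m n) })
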